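{- There is a constant $c>0$ such that for all sufficiently large $n$, \[ \mathit{Gap}_{+/\lor}(n)\;=\;\max_{A\in\{0,1\}^{n\times n}} \frac{C_{+}(A)}{C_{\lor}(A)} \;\ge\; c\,\frac{n^{1/2}}{\log^2 n}, \] i.e. $\mathit{Gap}_{+/\lor}(n)=\Omega(n^{1/2}/\log^2 n)$.
   Context: A circuit is a directed acyclic graph whose in-degree-zero vertices are input gates $x_1,\dots,x_n$ and whose other vertices are arithmetic gates of unbounded fan-in; some gates are designated output gates $y_1,\dots,y_m$. The size of a circuit is its number of wires (edges). For a boolean $m\times n$ matrix $A=(a_{ij})$: an OR-circuit computes $A$ if, when each gate computes the boolean OR of its children, each output computes $y_i=\bigvee_j a_{ij}x_j$ (as a formal linear form over the boolean semiring $(\{0,1\},\lor,\land)$); a SUM-circuit computes $A$ if, when each gate computes the integer sum of its children, each output computes the formal linear form $y_i=\sum_j a_{ij}x_j$ over the non-negative integers (equivalently, there is exactly one directed path from $x_j$ to $y_i$ if $a_{ij}=1$ and none otherwise); an XOR-circuit computes $A$ if, with gates computing sums modulo 2, $y_i=\sum_j a_{ij}x_j$ over $\mathrm{GF}(2)$. $C_\lor(A)$, $C_+(A)$, $C_\oplus(A)$ denote the minimum size of an OR-, SUM-, XOR-circuit computing $A$. For $X,Y\in\{\lor,+,\oplus\}$, $\mathit{Gap}_{X/Y}(n)=\max_{A\in\{0,1\}^{n\times n}} C_X(A)/C_Y(A)$. Logarithms are base 2. -}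

module Defs where

open import Data.Nat using (ℕ; zero; suc; _+_; _*_; _≤_; _<_; _^_)
open import Data.Nat.Logarithm using (⌈log₂_⌉)
open import Data.Bool using (Bool; true; false; _∨_; if_then_else_)
open import Data.Fin using (Fin; zero; suc; _≟_)
open import Data.Product using (Σ; _×_)
open import Relation.Nullary using (does)
open import Relation.Binary.PropositionalEquality using (_≡_)

Matrix : ℕ → ℕ → Set
Matrix m n = Fin m → Fin n → Bool

foldFin : {A : Set} → (A → A → A) → A → (m : ℕ) → (Fin m → A) → A
foldFin _⊕_ e zero    f = e
foldFin _⊕_ e (suc m) f = f zero ⊕ foldFin _⊕_ e m (λ i → f (suc i))

-- Gates of a circuit on n inputs, listed in a topological order.
-- In  Gates n k  there are k (arithmetic) gates.  The vertices of such a
-- circuit are  Fin (k + n):  index zero is the most recently added gate,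
-- older gates follow, and the last n indices are the input gates x_1..x_n.
-- A new gate is given by its set of children (a subset of the existing
-- vertices), so it has unbounded fan-in and there are no multi-edges.
data Gates (n : ℕ) : ℕ → Set where
  []  : Gates n 0
  _▷_ : {k : ℕ} → Gates n k → (Fin (k + n) → Bool) → Gates n (suc k)

record Circuit (n m : ℕ) : Set where
  field
    gates : ℕ
    body  : Gates n gates
    out   : Fin m → Fin (gates + n)
open Circuit public

countTrue : (m : ℕ) → (Fin m → Bool) → ℕ
countTrue m f = foldFin _+_ 0 m (λ i → if f i then 1 else 0)

wires : {n k : ℕ} → Gates n k → ℕ
wires []              = 0
wires (_▷_ {k} G ch)  = countTrue (k + _) ch + wires G

size : {n m : ℕ} → Circuit n m → ℕ
size C = wires (body C)

-- Formal linear form computed at each vertex over the boolean semiring.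
evalOR : {n k : ℕ} → Gates n k → Fin (k + n) → Fin n → Bool
evalOR []             i       j = does (i ≟ j)
evalOR (_▷_ {k} G ch) zero    j =
  foldFin _∨_ false (k + _) (λ v → if ch v then evalOR G v j else false)
evalOR (G ▷ ch)       (suc i) j = evalOR G i j

-- Formal linear form computed at each vertex over the non-negative integers.
evalSUM : {n k : ℕ} → Gates n k → Fin (k + n) → Fin n → ℕ
evalSUM []             i       j = if does (i ≟ j) then 1 else 0
evalSUM (_▷_ {k} G ch) zero    j =
  foldFin _+_ 0 (k + _) (λ v → if ch v then evalSUM G v j else 0)
evalSUM (G ▷ ch)       (suc i) j = evalSUM G i j

ComputesOR : {m n : ℕ} → Matrix m n → Circuit n m → Set
ComputesOR A C = ∀ i j → evalOR (body C) (out C i) j ≡ A i j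

ComputesSUM : {m n : ℕ} → Matrix m n → Circuit n m → Set
ComputesSUM A C = ∀ i j → evalSUM (body C) (out C i) j ≡ (if A i j then 1 else 0)

IsMinOR : {m n : ℕ} → Matrix m n → Circuit n m → Set
IsMinOR A D = ComputesOR A D × (∀ D' → ComputesOR A D' → size D ≤ size D')

{-# OPTIONS --safe #-}
module Submission where

-- Let Ī be the complement of the k × k identity matrix and A an N × N matrix with about half of its entries 1
-- and no monochromatic t × t submatrix, t = O(log N); the witness is Ī ⊗ A with k = N = Θ(√n).
-- Over OR, Ī has rank O(log k), and with shared partial disjunctions and a four-Russians circuit for A of size
-- O(N² / log N) the whole matrix costs O(n). In a SUM-circuit call a vertex low if its linear form meets fewer
-- than t columns of A. The wires leading from low to high vertices partition Ī ⊗ A into rectangles meeting at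
-- most t rows and t columns of A each. For every 1 in A the rectangles meeting it partition a copy of Ī, whose
-- rank is at least k − 1, so there are at least (k − 1) |A| / t² = Ω(n^(3/2) / log² n) of them.

open import Defs
open import Algebra.Properties.CommutativeSemigroup using (interchange)
open import Data.Bool using (Bool; true; false; _∨_; _∧_; _xor_; not; if_then_else_)
open import Data.Bool.ListAction using (any)
import Data.Bool.Properties as Bool
open import Data.Empty using (⊥; ⊥-elim)
open import Data.Fin as Fin using (Fin; zero; suc; combine; remQuot; _↑ˡ_; splitAt; inject≤; fromℕ<)
import Data.Fin.Properties as Fin
open import Data.List using (List; []; _∷_; map; length; _++_; allFin; upTo; concatMap; cartesianProduct; cartesianProductWith)
open import Data.List.Membership.Propositional using (_∈_; find; lose)
open import Data.List.Membership.Propositional.Properties using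
  (∈-map⁺; ∈-map⁻; ∈-++⁺ˡ; ∈-++⁺ʳ; ∈-allFin; ∈-upTo⁺; ∈-concatMap⁺; ∈-cartesianProduct⁺; ∈-cartesianProductWith⁺)
open import Data.List.Properties using (length-map; length-++; length-tabulate)
open import Data.List.Relation.Unary.All as All using (All; []; _∷_)
import Data.List.Relation.Unary.All.Properties as All
open import Data.List.Relation.Unary.Any as Any using (Any; here; there)
import Data.List.Relation.Unary.Any.Properties as Any
open import Data.Nat
open import Data.Nat.DivMod using (m≡m%n+[m/n]*n; m%n<n; m/n*n≤m)
open import Data.Nat.Logarithm using (⌈log₂_⌉; ⌈log₂⌉-mono-≤; ⌈log₂2^n⌉≡n)
open import Data.Nat.Properties
open import Data.Nat.Tactic.RingSolver using (solve-∀)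
open import Data.Product using (Σ; ∃; _×_; _,_; proj₁; proj₂; curry)
open import Data.Product.Function.NonDependent.Propositional using (_×-↔_)
open import Data.Sum using (_⊎_; inj₁; inj₂; [_,_]′)
open import Data.Unit using (tt)
open import Data.Vec as Vec using (Vec; []; _∷_; lookup; tabulate; replicate; _[_]≔_)
open import Data.Vec.Properties using (lookup-replicate; lookup∘tabulate)
open import Data.Vec.Relation.Binary.Pointwise.Extensional using (ext; Pointwise-≡⇒≡)
open import Function
open import Function.Properties.Inverse using (↔-refl; ↔-sym; ↔-trans; Inverse⇒Injection)
open import Relation.Binary.PropositionalEquality
open import Relation.Nullary
open import Relation.Nullary.Decidable using (dec-true; dec-false)
open import Relation.Unary using (Decidable)

open Equivalence using () renaming (to to ⇒; from to ⇐)

-- What separates the two models is overlap. Rectangles that merely cover `Ī` may overlap, and about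
-- 2 log k of them suffice. In a SUM-circuit entries add up exactly and nothing cancels, so rank
-- applies. The factor `A` stops one rectangle from serving many copies of `Ī` at once. The ratio is
-- taken against a minimal OR-circuit, which has to be produced constructively: a finite search
-- needs the number of gates bounded in terms of the number of wires. Squaring the inequality avoids
-- roots. An arbitrary n is reached by padding: with N a power of 4, N² ≤ n < 16 N².

-- Finite sums and subsets of `Fin m`

𝟙 : Bool → ℕ
𝟙 b = if b then 1 else 0

∑ : (m : ℕ) → (Fin m → ℕ) → ℕ
∑ = foldFin _+_ 0

∑-cong : ∀ m {f g : Fin m → ℕ} → (∀ i → f i ≡ g i) → ∑ m f ≡ ∑ m g
∑-cong zero    e = refl
∑-cong (suc m) e = cong₂ _+_ (e zero) (∑-cong m (e ∘ suc))

∑-mono : ∀ m {f g : Fin m → ℕ} → (∀ i → f i ≤ g i) → ∑ m f ≤ ∑ m g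
∑-mono zero    e = z≤n
∑-mono (suc m) e = +-mono-≤ (e zero) (∑-mono m (e ∘ suc))

∑-zero : ∀ m → ∑ m (λ _ → 0) ≡ 0
∑-zero zero    = refl
∑-zero (suc m) = ∑-zero m

∑-+ : ∀ m (f g : Fin m → ℕ) → ∑ m (λ i → f i + g i) ≡ ∑ m f + ∑ m g
∑-+ zero    f g = refl
∑-+ (suc m) f g = begin
  (f zero + g zero) + ∑ m (λ i → f (suc i) + g (suc i)) ≡⟨ cong (f zero + g zero +_) (∑-+ m _ _) ⟩
  (f zero + g zero) + (∑ m (f ∘ suc) + ∑ m (g ∘ suc))   ≡⟨ interchange +-commutativeSemigroup (f zero) (g zero) _ _ ⟩
  ∑ (suc m) f + ∑ (suc m) g                             ∎
  where open ≡-Reasoning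

∑-*ˡ : ∀ m a (f : Fin m → ℕ) → ∑ m (λ i → a * f i) ≡ a * ∑ m f
∑-*ˡ zero    a f = sym (*-zeroʳ a)
∑-*ˡ (suc m) a f = trans (cong (a * f zero +_) (∑-*ˡ m a _)) (sym (*-distribˡ-+ a _ _))

∑-const : ∀ m a → ∑ m (λ _ → a) ≡ m * a
∑-const zero    a = refl
∑-const (suc m) a = cong (a +_) (∑-const m a)

∑-single : ∀ m (f : Fin m → ℕ) u → (∀ v → v ≢ u → f v ≡ 0) → ∑ m f ≡ f u
∑-single (suc m) f zero    h = trans (cong (f zero +_)
  (trans (∑-cong m λ v → h (suc v) λ ()) (∑-zero m))) (+-identityʳ _)
∑-single (suc m) f (suc u) h = trans (cong (_+ ∑ m (f ∘ suc)) (h zero λ ()))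
  (∑-single m (f ∘ suc) u λ v v≢u → h (suc v) λ { refl → v≢u refl })

term≤∑ : ∀ m (f : Fin m → ℕ) u → f u ≤ ∑ m f
term≤∑ (suc m) f zero    = m≤m+n _ _
term≤∑ (suc m) f (suc u) = ≤-trans (term≤∑ m (f ∘ suc) u) (m≤n+m _ _)

elements : ∀ m → (Fin m → Bool) → List (Fin m)
elements zero    f = []
elements (suc m) f with f zero
... | true  = zero ∷ map suc (elements m (f ∘ suc))
... | false = map suc (elements m (f ∘ suc))

length-elements : ∀ m f → length (elements m f) ≡ countTrue m f
length-elements zero    f = refl
length-elements (suc m) f with f zero
... | true  = cong suc (trans (length-map suc (elements m (f ∘ suc))) (length-elements m (f ∘ suc)))
... | false = trans (length-map suc (elements m (f ∘ suc))) (length-elements m (f ∘ suc))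

countTrue-mono : ∀ m {f g : Fin m → Bool} → (∀ i → f i ≡ true → g i ≡ true) → countTrue m f ≤ countTrue m g
countTrue-mono m {f} {g} h = ∑-mono m λ i → aux (f i) (g i) (h i)
  where
  aux : ∀ a b → (a ≡ true → b ≡ true) → 𝟙 a ≤ 𝟙 b
  aux false b h = z≤n
  aux true  b h = ≤-reflexive (cong 𝟙 (sym (h refl)))

countTrue-unique : ∀ m (f : Fin m → Bool) → (∀ i j → f i ≡ true → f j ≡ true → i ≡ j) → countTrue m f ≤ 1
countTrue-unique zero    f h = z≤n
countTrue-unique (suc m) f h with f zero in eq
... | false = countTrue-unique m (f ∘ suc) λ i j p q → Fin-suc-inj (h (suc i) (suc j) p q)
  where
  Fin-suc-inj : ∀ {m} {i j : Fin m} → Fin.suc i ≡ suc j → i ≡ j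
  Fin-suc-inj refl = refl
... | true  = s≤s (≤-reflexive (trans (∑-cong m λ i → cong 𝟙 (Bool.¬-not λ p → zero≢suc (h zero (suc i) eq p))) (∑-zero m)))
  where
  zero≢suc : ∀ {m} {i : Fin m} → Fin.zero ≡ suc i → ⊥
  zero≢suc ()

-- Minimal OR-circuits

⋁ : (m : ℕ) → (Fin m → Bool) → Bool
⋁ = foldFin _∨_ false

⋁-cong : ∀ m {f g : Fin m → Bool} → (∀ i → f i ≡ g i) → ⋁ m f ≡ ⋁ m g
⋁-cong zero    e = refl
⋁-cong (suc m) e = cong₂ _∨_ (e zero) (⋁-cong m (e ∘ suc))

⋁-false : ∀ m → ⋁ m (λ _ → false) ≡ false
⋁-false zero    = refl
⋁-false (suc m) = ⋁-false m

vertexSet : ∀ {m} → List (Fin m) → Vec Bool m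
vertexSet []       = replicate _ false
vertexSet (u ∷ us) = vertexSet us [ u ]≔ true

countTrue-insert : ∀ {m} (s : Vec Bool m) u → countTrue m (lookup (s [ u ]≔ true)) ≤ suc (countTrue m (lookup s))
countTrue-insert (b ∷ s) zero    = s≤s (m≤n+m _ (𝟙 b))
countTrue-insert (b ∷ s) (suc u) = ≤-trans (+-monoʳ-≤ (𝟙 b) (countTrue-insert s u)) (≤-reflexive (+-suc (𝟙 b) _))

countTrue-vertexSet : ∀ {m} (us : List (Fin m)) → countTrue m (lookup (vertexSet us)) ≤ length us
countTrue-vertexSet {m} []  = ≤-reflexive (trans (∑-cong m λ i → cong 𝟙 (lookup-replicate i false)) (∑-zero m))
countTrue-vertexSet (u ∷ us) = ≤-trans (countTrue-insert (vertexSet us) u) (s≤s (countTrue-vertexSet us))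

-- Idempotence of `∨` absorbs a vertex inserted twice. Repetitions do occur: normalising a circuit
-- may identify several children of a gate.
⋁-insert : ∀ {m} (g : Fin m → Bool) s u →
  ⋁ m (λ v → if lookup (s [ u ]≔ true) v then g v else false) ≡ g u ∨ ⋁ m (λ v → if lookup s v then g v else false)
⋁-insert g (true  ∷ s) zero    =
  trans (cong (_∨ ⋁ _ (λ v → if lookup s v then g (suc v) else false)) (sym (Bool.∨-idem (g zero)))) (Bool.∨-assoc (g zero) _ _)
⋁-insert g (false ∷ s) zero    = refl
⋁-insert g (b ∷ s)     (suc u) = begin
  h ∨ ⋁ _ (λ v → if lookup (s [ u ]≔ true) v then g (suc v) else false) ≡⟨ cong (h ∨_) (⋁-insert (g ∘ suc) s u) ⟩
  h ∨ (g (suc u) ∨ r)   ≡⟨ Bool.∨-assoc h _ _ ⟨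
  (h ∨ g (suc u)) ∨ r   ≡⟨ cong (_∨ r) (Bool.∨-comm h _) ⟩
  (g (suc u) ∨ h) ∨ r   ≡⟨ Bool.∨-assoc (g (suc u)) _ _ ⟩
  g (suc u) ∨ (h ∨ r)   ∎
  where
  open ≡-Reasoning
  h = if b then g zero else false
  r = ⋁ _ (λ v → if lookup s v then g (suc v) else false)

⋁-vertexSet : ∀ {m} (g : Fin m → Bool) us → ⋁ m (λ v → if lookup (vertexSet us) v then g v else false) ≡ any g us
⋁-vertexSet {m} g []  = trans (⋁-cong m λ v → cong (if_then g v else false) (lookup-replicate v false)) (⋁-false m)
⋁-vertexSet g (u ∷ us) = trans (⋁-insert g (vertexSet us) u) (cong (g u ∨_) (⋁-vertexSet g us))

any-map : ∀ {A B : Set} (g : B → Bool) (f : A → B) us → any g (map f us) ≡ any (g ∘ f) us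
any-map g f []       = refl
any-map g f (u ∷ us) = cong (g (f u) ∨_) (any-map g f us)

any-cong : ∀ {A : Set} {f g : A → Bool} → (∀ x → f x ≡ g x) → ∀ us → any f us ≡ any g us
any-cong h []       = refl
any-cong h (u ∷ us) = cong₂ _∨_ (h u) (any-cong h us)

any-elements : ∀ m (g f : Fin m → Bool) → any g (elements m f) ≡ ⋁ m (λ v → if f v then g v else false)
any-elements zero    g f = refl
any-elements (suc m) g f with f zero
... | true  = cong (g zero ∨_) (trans (any-map g suc (elements m (f ∘ suc))) (any-elements m (g ∘ suc) (f ∘ suc)))
... | false = trans (any-map g suc (elements m (f ∘ suc))) (any-elements m (g ∘ suc) (f ∘ suc))

length-cartesianProductWith : ∀ {A B C : Set} (f : A → B → C) xs ys → length (cartesianProductWith f xs ys) ≡ length xs * length ys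
length-cartesianProductWith f []       ys = refl
length-cartesianProductWith f (x ∷ xs) ys = trans (length-++ (map (f x) ys))
  (cong₂ _+_ (length-map (f x) ys) (length-cartesianProductWith f xs ys))

allBits : ∀ m → List (Vec Bool m)
allBits zero    = [] ∷ []
allBits (suc m) = cartesianProductWith _∷_ (true ∷ false ∷ []) (allBits m)

∈-allBits : ∀ {m} (s : Vec Bool m) → s ∈ allBits m
∈-allBits []          = here refl
∈-allBits (true  ∷ s) = ∈-cartesianProductWith⁺ _∷_ {xs = true ∷ false ∷ []} (here refl) (∈-allBits s)
∈-allBits (false ∷ s) = ∈-cartesianProductWith⁺ _∷_ {xs = true ∷ false ∷ []} (there (here refl)) (∈-allBits s)

-- Child sets are bit vectors here because functions that agree pointwise need not be equal; only
-- circuits built from vectors can be shown to be members of an explicit list.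
_◂_ : ∀ {n k} → Gates n k → Vec Bool (k + n) → Gates n (suc k)
G ◂ s = G ▷ lookup s

allGates : ∀ n k → List (Gates n k)
allGates n zero    = [] ∷ []
allGates n (suc k) = cartesianProductWith _◂_ (allGates n k) (allBits (k + n))

-- Gates without children all compute 0, so one of them suffices: this bounds the number of gates by the
-- number of wires.
record Normalised {n k} (G : Gates n k) : Set where
  field
    k′     : ℕ
    G′     : Gates n k′
    few    : k′ ≤ suc (wires G)
    listed : G′ ∈ allGates n k′
    cheap  : wires G′ ≤ wires G
    φ      : Fin (k + n) → Fin (k′ + n)
    same   : ∀ v j → evalOR G′ (φ v) j ≡ evalOR G v j
    null   : Fin (k′ + n)
    isNull : ∀ j → evalOR G′ null j ≡ false

normalise : ∀ {n k} (G : Gates n k) → Normalised G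
-- The shared null gate is placed at the bottom; it accounts for the extra 1 in `few`.
normalise {n} [] = record
  { k′ = 1 ; G′ = [] ◂ vertexSet []
  ; few = ≤-refl
  ; listed = ∈-cartesianProductWith⁺ _◂_ {xs = allGates n 0} (here refl) (∈-allBits (vertexSet []))
  ; cheap = ≤-trans (≤-reflexive (+-identityʳ _)) (countTrue-vertexSet {n} [])
  ; φ = suc ; same = λ v j → refl
  ; null = zero ; isNull = λ j → ⋁-vertexSet (λ v → evalOR [] v j) [] }
normalise {n} (_▷_ {k} G ch) = go (elements (k + n) ch) refl
  where
  open Normalised (normalise G)
  go : ∀ us → elements (k + n) ch ≡ us → Normalised (G ▷ ch)
  go [] eq = record
    { k′ = k′ ; G′ = G′ ; few = ≤-trans few (s≤s (m≤n+m _ _)) ; listed = listed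
    ; cheap = ≤-trans cheap (m≤n+m _ _)
    ; φ = λ { zero → null ; (suc v) → φ v }
    ; same = λ { zero j → trans (isNull j)
                   (trans (cong (any (λ v → evalOR G v j)) (sym eq)) (any-elements (k + n) (λ v → evalOR G v j) ch))
               ; (suc v) j → same v j }
    ; null = null ; isNull = isNull }
  -- A gate that is kept has a child, and the wire to that child pays for it in `few`.
  go us@(u ∷ us′) eq = record
    { k′ = suc k′ ; G′ = G′ ◂ s
    ; few = s≤s (≤-trans few (+-monoˡ-≤ (wires G) (≤-trans (s≤s z≤n) (≤-reflexive len))))
    ; listed = ∈-cartesianProductWith⁺ _◂_ listed (∈-allBits s)
    ; cheap = +-mono-≤ (≤-trans (countTrue-vertexSet (map φ us)) (≤-reflexive (trans (length-map φ us) len))) cheap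
    ; φ = λ { zero → zero ; (suc v) → suc (φ v) }
    ; same = λ { zero j → same₀ j ; (suc v) j → same v j }
    ; null = suc null ; isNull = isNull }
    where
    s = vertexSet (map φ us)
    len : length us ≡ countTrue (k + n) ch
    len = trans (cong length (sym eq)) (length-elements (k + n) ch)
    same₀ : ∀ j → evalOR (G′ ◂ s) zero j ≡ evalOR (G ▷ ch) zero j
    same₀ j = begin
      evalOR (G′ ◂ s) zero j                ≡⟨ ⋁-vertexSet (λ v → evalOR G′ v j) (map φ us) ⟩
      any (λ v → evalOR G′ v j) (map φ us)  ≡⟨ any-map _ φ us ⟩
      any (λ v → evalOR G′ (φ v) j) us      ≡⟨ any-cong (λ v → same v j) us ⟩
      any (λ v → evalOR G v j) us           ≡⟨ cong (any _) eq ⟨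
      any (λ v → evalOR G v j) (elements (k + n) ch) ≡⟨ any-elements (k + n) _ ch ⟩
      evalOR (G ▷ ch) zero j                ∎
      where open ≡-Reasoning

minimise : ∀ {X : Set} {Q : X → Set} → Decidable Q → (μ : X → ℕ) (x₀ : X) → Q x₀ → (xs : List X) →
  ∃ λ x → Q x × μ x ≤ μ x₀ × (∀ {y} → y ∈ xs → Q y → μ x ≤ μ y)
minimise Q? μ x₀ q₀ [] = x₀ , q₀ , ≤-refl , λ ()
minimise {Q = Q} Q? μ x₀ q₀ (y ∷ ys) with minimise Q? μ x₀ q₀ ys
... | x , q , x≤x₀ , least with Q? y
...   | no ¬q = x , q , x≤x₀ , λ { (here refl) q′ → ⊥-elim (¬q q′) ; (there p) → least p }
...   | yes q′ with ≤-total (μ x) (μ y)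
...     | inj₁ x≤y = x , q , x≤x₀ , λ { (here refl) _ → x≤y ; (there p) → least p }
...     | inj₂ y≤x = y , q′ , ≤-trans y≤x x≤x₀ , λ { (here refl) _ → ≤-refl ; (there p) r → ≤-trans y≤x (least p r) }

module _ {m n : ℕ} (A : Matrix m n) where

  HasOutputs : ∃ (Gates n) → Set
  HasOutputs (k , G) = ∀ i → ∃ λ v → ∀ j → evalOR G v j ≡ A i j

  hasOutputs? : Decidable HasOutputs
  hasOutputs? (k , G) = Fin.all? λ i → Fin.any? λ v → Fin.all? λ j → evalOR G v j Bool.≟ A i j

  allGatesUpTo : ℕ → List (∃ (Gates n))
  allGatesUpTo s = concatMap (λ k → map (k ,_) (allGates n k)) (upTo s)

  -- A competitor larger than `D₀` loses to `D₀`, which takes part in the search. Any other has a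
  -- normal form with at most `1 + size D₀` gates and no more wires, and this form is on the list;
  -- the 2 is there because `upTo` excludes its bound.
  minimalOR : (D₀ : Circuit n m) → ComputesOR A D₀ → ∃ λ D → IsMinOR A D × size D ≤ size D₀
  minimalOR D₀ ok₀ with minimise hasOutputs? (wires ∘ proj₂) (gates D₀ , body D₀)
    (λ i → out D₀ i , ok₀ i) (allGatesUpTo (2 + size D₀))
  ... | (k , G) , ok , G≤D₀ , least = D , ((λ i → proj₂ (ok i)) , minimal) , G≤D₀
    where
    D : Circuit n m
    D = record { gates = k ; body = G ; out = proj₁ ∘ ok }
    minimal : ∀ D′ → ComputesOR A D′ → size D ≤ size D′
    minimal D′ ok′ with ≤-total (size D₀) (size D′)
    ... | inj₁ D₀≤D′ = ≤-trans G≤D₀ D₀≤D′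
    ... | inj₂ D′≤D₀ = ≤-trans (least member outputs) cheap
      where
      open Normalised (normalise (body D′))
      member : (k′ , G′) ∈ allGatesUpTo (2 + size D₀)
      member = ∈-concatMap⁺ (λ k → map (k ,_) (allGates n k)) {xs = upTo (2 + size D₀)}
        (Any.map (λ { refl → ∈-map⁺ (k′ ,_) listed }) (∈-upTo⁺ (s≤s (≤-trans few (s≤s D′≤D₀)))))
      outputs : HasOutputs (k′ , G′)
      outputs i = φ (out D′ i) , λ j → trans (same (out D′ i) j) (ok′ i j)

-- The OR upper bound

∈-elements : ∀ m (f : Fin m → Bool) v → (f v ≡ true) ⇔ (v ∈ elements m f)
∈-elements m f v = mk⇔ (to m f v) (from m f v)
  where
  to : ∀ m (f : Fin m → Bool) v → f v ≡ true → v ∈ elements m f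
  to (suc m) f v p with f zero in eq
  to (suc m) f zero    p | true  = here refl
  to (suc m) f (suc v) p | true  = there (∈-map⁺ suc (to m (f ∘ suc) v p))
  to (suc m) f zero    p | false with () ← trans (sym p) eq
  to (suc m) f (suc v) p | false = ∈-map⁺ suc (to m (f ∘ suc) v p)
  from : ∀ m (f : Fin m → Bool) v → v ∈ elements m f → f v ≡ true
  fromMap : ∀ m (f : Fin (suc m) → Bool) v → v ∈ map suc (elements m (f ∘ suc)) → f v ≡ true
  fromMap m f v p with u , u∈ , refl ← ∈-map⁻ suc p = from m (f ∘ suc) u u∈
  from (suc m) f v p with f zero in eq
  from (suc m) f v (here refl) | true  = eq
  from (suc m) f v (there p)   | true  = fromMap m f v p
  from (suc m) f v p           | false = fromMap m f v p

any-true : ∀ {A : Set} (f : A → Bool) xs → (any f xs ≡ true) ⇔ Any (λ x → f x ≡ true) xs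
any-true f xs = mk⇔ (to xs) from
  where
  to : ∀ xs → any f xs ≡ true → Any (λ x → f x ≡ true) xs
  to (x ∷ xs) p with f x in eq
  ... | true  = here eq
  ... | false = there (to xs p)
  from : ∀ {xs} → Any (λ x → f x ≡ true) xs → any f xs ≡ true
  from (here p)              rewrite p = refl
  from (there {x} {xs} p) rewrite from p = Bool.∨-zeroʳ (f x)

length-allBits : ∀ d → length (allBits d) ≡ 2 ^ d
length-allBits zero    = refl
length-allBits (suc d) = trans (length-cartesianProductWith _∷_ (true ∷ false ∷ []) (allBits d)) (cong (2 *_) (length-allBits d))

bits↔Fin : ∀ d → Vec Bool d ↔ Fin (2 ^ d)
bits↔Fin zero    = mk↔ₛ′ (λ _ → zero) (λ _ → []) (λ { zero → refl }) (λ { [] → refl })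
bits↔Fin (suc d) = ↔-trans uncons (↔-trans (↔-sym Fin.2↔Bool ×-↔ bits↔Fin d) (↔-sym Fin.*↔×))
  where
  uncons : Vec Bool (suc d) ↔ (Bool × Vec Bool d)
  uncons = mk↔ₛ′ (λ { (b ∷ s) → b , s }) (λ { (b , s) → b ∷ s }) (λ _ → refl) (λ { (b ∷ s) → refl })

×↔Fin : ∀ {X Y : Set} {a b} → X ↔ Fin a → Y ↔ Fin b → (X × Y) ↔ Fin (a * b)
×↔Fin f g = ↔-trans (f ×-↔ g) (↔-sym Fin.*↔×)

-- Val x is the support of the formal linear form at vertex x.
record Realises (n : ℕ) (X : Set) (Val : X → Fin n → Set) (c : ℕ) : Set₁ where
  field
    k       : ℕ
    G       : Gates n k
    vertex  : X → Fin (k + n)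
    correct : ∀ x j → (evalOR G (vertex x) j ≡ true) ⇔ Val x j
    cost    : wires G ≤ c

restrict : ∀ {n} {X Y : Set} {Val : X → Fin n → Set} {c c′} (f : Y → X) {W : Y → Fin n → Set} →
  (∀ y j → Val (f y) j ⇔ W y j) → c ≤ c′ →
  Realises n X Val c → Realises n Y W c′
restrict f e c≤c′ R = record
  { k = k ; G = G ; vertex = vertex ∘ f
  ; correct = λ y j → mk⇔ (⇒ (e y j) ∘ ⇒ (correct (f y) j)) (⇐ (correct (f y) j) ∘ ⇐ (e y j))
  ; cost = ≤-trans cost c≤c′ }
  where open Realises R

module _ {n : ℕ} {X : Set} {Val : X → Fin n → Set} where

  -- The new gates take their children from `X` only, so they never feed one another and can be
  -- stacked in any order while the names of old vertices survive.
  layerFin : ∀ {c b} m (ch : Fin m → List X) → (∀ y → length (ch y) ≤ b) → Realises n X Val c →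
    Realises n (X ⊎ Fin m) [ Val , (λ y j → Any (λ x → Val x j) (ch y)) ]′ (m * b + c)
  layerFin zero ch short R = record
    { k = k ; G = G ; vertex = λ { (inj₁ x) → vertex x } ; correct = λ { (inj₁ x) → correct x } ; cost = cost }
    where open Realises R
  layerFin {c} {b} (suc m) ch short R = record
    { k = suc k ; G = G ◂ vertexSet us
    ; vertex = λ { (inj₁ x) → suc (vertex (inj₁ x)) ; (inj₂ zero) → zero ; (inj₂ (suc i)) → suc (vertex (inj₂ i)) }
    ; correct = λ { (inj₁ x) → correct (inj₁ x) ; (inj₂ zero) → correct₀ ; (inj₂ (suc i)) → correct (inj₂ i) }
    ; cost = ≤-trans (+-mono-≤ (≤-trans (countTrue-vertexSet us) (≤-trans (≤-reflexive (length-map _ (ch zero))) (short zero))) cost)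
                     (≤-reflexive (sym (+-assoc b (m * b) c))) }
    where
    open Realises (layerFin m (ch ∘ suc) (short ∘ suc) R)
    us = map (vertex ∘ inj₁) (ch zero)
    correct₀ : ∀ j → (evalOR (G ◂ vertexSet us) zero j ≡ true) ⇔ Any (λ x → Val x j) (ch zero)
    correct₀ j rewrite ⋁-vertexSet (λ v → evalOR G v j) us = mk⇔
      (λ p → Any.map (λ {x} → ⇒ (correct (inj₁ x) j)) (Any.map⁻ (⇒ (any-true _ us) p)))
      (λ p → ⇐ (any-true _ us) (Any.map⁺ (Any.map (λ {x} → ⇐ (correct (inj₁ x) j)) p)))

  layer : ∀ {Y : Set} {c b m} {W : Y → Fin n → Set} → Y ↔ Fin m → (ch : Y → List X) → (∀ y → length (ch y) ≤ b) →
    (∀ y j → Any (λ x → Val x j) (ch y) ⇔ W y j) → Realises n X Val c → Realises n (X ⊎ Y) [ Val , W ]′ (m * b + c)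
  layer {Y} {m = m} {W} e ch short sound R = restrict [ inj₁ , inj₂ ∘ to ]′ sound′ ≤-refl
    (layerFin m (ch ∘ from) (short ∘ from) R)
    where
    open Inverse e
    sound′ : ∀ (y : X ⊎ Y) j → [ Val , (λ z j → Any (λ x → Val x j) (ch (from z))) ]′ ([ inj₁ , inj₂ ∘ to ]′ y) j ⇔ [ Val , W ]′ y j
    sound′ (inj₁ x) j = mk⇔ id id
    sound′ (inj₂ y) j rewrite strictlyInverseʳ y = sound y j

-- The method of four Russians: the columns of A come in P blocks of width ℓ, and a gate is spent on each of
-- the 2 ^ ℓ subsets of each block.
module FourRussians {N P ℓ : ℕ} (A : Fin N → Fin (P * ℓ) → Bool) where

  -- For `z` families of inputs: `N` row gates with one child in each of the `P` blocks, above
  -- `P * 2 ^ ℓ` subset gates with at most `ℓ` children each.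
  russianCost : ℕ → ℕ
  russianCost z = z * N * P + z * (P * 2 ^ ℓ) * ℓ

  apply : ∀ {n c} {X : Set} {Val : X → Fin n → Set} {Z : Set} {z} → Z ↔ Fin z → (ξ : Z → Fin (P * ℓ) → X) → Realises n X Val c →
    Realises n (X ⊎ (Z × Fin N)) [ Val , (λ { (ζ , i) c → ∃ λ j → A i j ≡ true × Val (ξ ζ j) c }) ]′
      (russianCost z + c)
  apply {n} {c} {X} {Val} {Z} {z} e ξ R = restrict keep keep-sound (≤-reflexive (sym (+-assoc (z * N * P) _ c)))
    (layer (×↔Fin e (↔-refl {A = Fin N})) chosen (λ _ → ≤-reflexive (trans (length-map _ (allFin P)) (length-tabulate {n = P} id))) chosen-sound
    (layer (×↔Fin e (×↔Fin (↔-refl {A = Fin P}) (bits↔Fin ℓ))) subset (λ { (ζ , p , s) → subset-short ζ p s }) subset-sound R))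
    where
    subset : Z × Fin P × Vec Bool ℓ → List X
    subset (ζ , p , s) = map (ξ ζ ∘ combine p) (elements ℓ (lookup s))
    subset-short : ∀ ζ p s → length (subset (ζ , p , s)) ≤ ℓ
    subset-short ζ p s = begin
      length (subset (ζ , p , s))     ≡⟨ length-map (ξ ζ ∘ combine p) (elements ℓ (lookup s)) ⟩
      length (elements ℓ (lookup s))  ≡⟨ length-elements ℓ (lookup s) ⟩
      countTrue ℓ (lookup s)          ≤⟨ countTrue-mono ℓ (λ _ _ → refl) ⟩
      countTrue ℓ (λ _ → true)        ≡⟨ ∑-const ℓ 1 ⟩
      ℓ * 1                           ≡⟨ *-identityʳ ℓ ⟩
      ℓ                               ∎
      where open ≤-Reasoning
    Subset : Z × Fin P × Vec Bool ℓ → Fin n → Set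
    Subset (ζ , p , s) c = ∃ λ q → lookup s q ≡ true × Val (ξ ζ (combine p q)) c
    subset-sound : ∀ y c → Any (λ x → Val x c) (subset y) ⇔ Subset y c
    subset-sound (ζ , p , s) c = mk⇔
      (λ a → let q , q∈ , v = find (Any.map⁻ a) in q , ⇐ (∈-elements ℓ (lookup s) q) q∈ , v)
      (λ { (q , q∈ , v) → Any.map⁺ (lose (⇒ (∈-elements ℓ (lookup s) q) q∈) v) })
    -- A row restricted to a block is one of the prepared subsets, so one wire per block suffices.
    restriction : Fin N → Fin P → Vec Bool ℓ
    restriction i p = tabulate (A i ∘ combine p)
    chosen : Z × Fin N → List (X ⊎ (Z × Fin P × Vec Bool ℓ))
    chosen (ζ , i) = map (λ p → inj₂ (ζ , p , restriction i p)) (allFin P)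
    Applied : Z × Fin N → Fin n → Set
    Applied (ζ , i) c = ∃ λ j → A i j ≡ true × Val (ξ ζ j) c
    chosen-sound : ∀ y c → Any (λ x → [ Val , Subset ]′ x c) (chosen y) ⇔ Applied y c
    chosen-sound (ζ , i) c = mk⇔
      (λ a → let p , _ , v = find (Any.map⁻ a) in forth i ζ c p v)
      (λ { (j , aj , v) → Any.map⁺ (lose (∈-allFin (proj₁ (remQuot {P} ℓ j))) (back i ζ c j aj v)) })
      where
      forth : ∀ i ζ c p → Subset (ζ , p , restriction i p) c → Applied (ζ , i) c
      forth i ζ c p (q , aq , v) = combine p q , trans (sym (lookup∘tabulate (A i ∘ combine p) q)) aq , v
      back : ∀ i ζ c j → A i j ≡ true → Val (ξ ζ j) c → Subset (ζ , proj₁ (remQuot {P} ℓ j) , restriction i (proj₁ (remQuot {P} ℓ j))) c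
      back i ζ c j aj v =
        q , trans (lookup∘tabulate (A i ∘ combine (proj₁ (remQuot {P} ℓ j))) q) (trans (cong (A i) eq) aj) ,
        subst (λ j → Val (ξ ζ j) c) (sym eq) v
        where
        q = proj₂ (remQuot {P} ℓ j)
        eq = Fin.combine-remQuot {P} ℓ j
    keep : X ⊎ (Z × Fin N) → (X ⊎ (Z × Fin P × Vec Bool ℓ)) ⊎ (Z × Fin N)
    keep (inj₁ x) = inj₁ (inj₁ x)
    keep (inj₂ y) = inj₂ y
    keep-sound : ∀ y c → [ [ Val , Subset ]′ , Applied ]′ (keep y) c ⇔
      [ Val , (λ { (ζ , i) c → ∃ λ j → A i j ≡ true × Val (ξ ζ j) c }) ]′ y c
    keep-sound (inj₁ x) c = mk⇔ id id
    keep-sound (inj₂ y) c = mk⇔ id id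

  -- The complement of the identity on suc d bits is blockwise [ B J ; J B ] where B is the complement on d bits
  -- and J is all ones, so two of the products with A are shared by all blocks at each level.
  crownCost : ℕ → ℕ
  crownCost zero    = 0
  crownCost (suc d) = 2 ^ suc d * N * 2 + (crownCost d + (2 ^ d * (P * ℓ) * 2 + (russianCost 2 + 2 * (P * ℓ) * 2 ^ d)))

  -- The tensor product `Ī ⊗ A` applied to the family `ξ`; the factor `Ī` is the condition that the
  -- bit vectors differ.
  Crown : ∀ {n d} {X : Set} (Val : X → Fin n → Set) (ξ : Vec Bool d → Fin (P * ℓ) → X) → Vec Bool d × Fin N → Fin n → Set
  Crown Val ξ (a , i) c = ∃ λ b → ∃ λ j → a ≢ b × A i j ≡ true × Val (ξ b j) c

  -- Row `β ∷ a` collects the columns whose first bit differs from `β` (`half`, then `A`) and those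
  -- whose tail differs from `a`, whatever their first bit (`merge`, then the recursion). Columns
  -- differing in both are covered twice, which OR permits, so a single recursive call serves both
  -- halves. Two calls per level would pay for `A` about `2 ^ d` times instead of `d` times.
  crown : ∀ d {n c} {X : Set} {Val : X → Fin n → Set} (ξ : Vec Bool d → Fin (P * ℓ) → X) → Realises n X Val c →
    Realises n (X ⊎ (Vec Bool d × Fin N)) [ Val , Crown Val ξ ]′ (crownCost d + c)
  -- The complement of the 1 × 1 identity is zero: the gates have no children and cost nothing.
  crown zero {c = c} ξ R = restrict id (λ { (inj₁ x) c → mk⇔ id id ; (inj₂ y) c → mk⇔ id id }) (+-monoˡ-≤ c (≤-reflexive (*-zeroʳ (1 * N))))
    (layer (×↔Fin (bits↔Fin 0) (↔-refl {A = Fin N})) (λ _ → []) (λ _ → z≤n)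
      (λ { ([] , i) c → mk⇔ (λ ()) λ { ([] , _ , ne , _) → ⊥-elim (ne refl) } }) R)
  crown (suc d) {n} {c} {X} {Val} ξ R = restrict keep keep-sound (≤-reflexive cost-eq)
    (layer (×↔Fin (bits↔Fin (suc d)) (↔-refl {A = Fin N})) total (λ { (β ∷ a , i) → ≤-refl }) total-sound
    (crown d (curry inj₂)
    (layer (×↔Fin (bits↔Fin d) (↔-refl {A = Fin (P * ℓ)})) merge (λ _ → ≤-refl) merge-sound
    (apply (↔-sym Fin.2↔Bool) (curry inj₂)
    (layer (×↔Fin (↔-sym Fin.2↔Bool) (↔-refl {A = Fin (P * ℓ)})) half
      (λ _ → ≤-reflexive (trans (length-map _ (allBits d)) (length-allBits d))) half-sound R)))))
    where
    Half : Bool × Fin (P * ℓ) → Fin n → Set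
    Half (β , j) c = ∃ λ b → Val (ξ (not β ∷ b) j) c
    half : Bool × Fin (P * ℓ) → List X
    half (β , j) = map (λ b → ξ (not β ∷ b) j) (allBits d)
    half-sound : ∀ y c → Any (λ x → Val x c) (half y) ⇔ Half y c
    half-sound (β , j) c = mk⇔
      (λ a → let b , _ , v = find (Any.map⁻ a) in b , v)
      (λ { (b , v) → Any.map⁺ (lose (∈-allBits b) v) })
    X₁ = X ⊎ (Bool × Fin (P * ℓ))
    Val₁ : X₁ → Fin n → Set
    Val₁ = [ Val , Half ]′
    X₂ = X₁ ⊎ (Bool × Fin N)
    Val₂ : X₂ → Fin n → Set
    Val₂ = [ Val₁ , (λ { (β , i) c → ∃ λ j → A i j ≡ true × Half (β , j) c }) ]′
    Merge : Vec Bool d × Fin (P * ℓ) → Fin n → Set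
    Merge (b , j) c = ∃ λ β → Val (ξ (β ∷ b) j) c
    merge : Vec Bool d × Fin (P * ℓ) → List X₂
    merge (b , j) = inj₁ (inj₁ (ξ (true ∷ b) j)) ∷ inj₁ (inj₁ (ξ (false ∷ b) j)) ∷ []
    merge-sound : ∀ y c → Any (λ x → Val₂ x c) (merge y) ⇔ Merge y c
    merge-sound (b , j) c = mk⇔
      (λ { (here v) → true , v ; (there (here v)) → false , v })
      (λ { (true , v) → here v ; (false , v) → there (here v) })
    X₃ = X₂ ⊎ (Vec Bool d × Fin (P * ℓ))
    Val₃ : X₃ → Fin n → Set
    Val₃ = [ Val₂ , Merge ]′
    X₄ = X₃ ⊎ (Vec Bool d × Fin N)
    Val₄ : X₄ → Fin n → Set
    Val₄ = [ Val₃ , Crown Val₃ (curry inj₂) ]′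
    total : Vec Bool (suc d) × Fin N → List X₄
    total (β ∷ a , i) = inj₁ (inj₁ (inj₂ (β , i))) ∷ inj₂ (a , i) ∷ []
    total-sound : ∀ y c → Any (λ x → Val₄ x c) (total y) ⇔ Crown Val ξ y c
    total-sound (β ∷ a , i) c = mk⇔
      (λ { (here (j , aj , b , v)) → not β ∷ b , j , (λ eq → Bool.not-¬ refl (cong Vec.head eq)) , aj , v
         ; (there (here (b , j , a≢b , aj , β′ , v))) → β′ ∷ b , j , (λ eq → a≢b (cong Vec.tail eq)) , aj , v })
      back
      where
      back : Crown Val ξ (β ∷ a , i) c → Any (λ x → Val₄ x c) (total (β ∷ a , i))
      back (β′ ∷ b , j , ne , aj , v) with β Bool.≟ β′
      ... | yes refl = there (here (b , j , (λ { refl → ne refl }) , aj , β , v))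
      ... | no β≢β′  = here (j , aj , b , subst (λ z → Val (ξ (z ∷ b) j) c) (Bool.¬-not (β≢β′ ∘ sym)) v)
    keep : X ⊎ (Vec Bool (suc d) × Fin N) → X₄ ⊎ (Vec Bool (suc d) × Fin N)
    keep (inj₁ x) = inj₁ (inj₁ (inj₁ (inj₁ (inj₁ x))))
    keep (inj₂ y) = inj₂ y
    keep-sound : ∀ y c → [ Val₄ , Crown Val ξ ]′ (keep y) c ⇔ [ Val , Crown Val ξ ]′ y c
    keep-sound (inj₁ x) c = mk⇔ id id
    keep-sound (inj₂ y) c = mk⇔ id id
    cost-eq : 2 ^ suc d * N * 2 + (crownCost d + (2 ^ d * (P * ℓ) * 2 + (russianCost 2 + (2 * (P * ℓ) * 2 ^ d + c)))) ≡ crownCost (suc d) + c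
    cost-eq = lemma (2 ^ suc d * N * 2) (crownCost d) (2 ^ d * (P * ℓ) * 2) (russianCost 2) (2 * (P * ℓ) * 2 ^ d) c
      where
      lemma : ∀ u v w x y z → u + (v + (w + (x + (y + z)))) ≡ u + (v + (w + (x + y))) + z
      lemma = solve-∀

  -- `russianCost 2` is paid once per level, whereas the remaining terms double from level to level
  -- and form a geometric series.
  crownCost-≤ : ∀ d → crownCost d ≤ d * russianCost 2 + 2 ^ d * (4 * N + 4 * (P * ℓ))
  crownCost-≤ zero    = z≤n
  crownCost-≤ (suc d) = ≤-trans (+-monoʳ-≤ (2 ^ suc d * N * 2) (+-monoˡ-≤ _ (crownCost-≤ d)))
    (≤-reflexive (lemma (2 ^ d) N (P * ℓ) d (russianCost 2)))
    where
    lemma : ∀ K N M d r → 2 * K * N * 2 + (d * r + K * (4 * N + 4 * M) + (K * M * 2 + (r + 2 * M * K))) ≡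
      (r + d * r) + 2 * K * (4 * N + 4 * M)
    lemma = solve-∀

-- The SUM lower bound

-- (f , h) stands for the rank-one matrix with entry f c * h r in row r and column c.
Rectangle : ℕ → ℕ → Set
Rectangle m n = (Fin n → ℕ) × (Fin m → ℕ)

total : ∀ {m n} → List (Rectangle m n) → Fin m → Fin n → ℕ
total []             r c = 0
total ((f , h) ∷ es) r c = f c * h r + total es r c

total-++ : ∀ {m n} (es es′ : List (Rectangle m n)) r c → total (es ++ es′) r c ≡ total es r c + total es′ r c
total-++ []             es′ r c = refl
total-++ ((f , h) ∷ es) es′ r c = trans (cong (f c * h r +_) (total-++ es es′ r c)) (sym (+-assoc (f c * h r) _ _))

total-map : ∀ {m n} {K : Set} (e : K → Rectangle m n) {L : Set} (g : L → K) us r c → total (map e (map g us)) r c ≡ total (map (e ∘ g) us) r c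
total-map e g []       r c = refl
total-map e g (u ∷ us) r c = cong (_ +_) (total-map e g us r c)

total-elements : ∀ {m n} k (f : Fin k → Bool) (e : Fin k → Rectangle m n) r c →
  total (map e (elements k f)) r c ≡ ∑ k (λ u → if f u then proj₁ (e u) c * proj₂ (e u) r else 0)
total-elements zero    f e r c = refl
total-elements (suc k) f e r c with f zero
... | true  = cong (_ +_) (trans (total-map e suc (elements k (f ∘ suc)) r c) (total-elements k (f ∘ suc) (e ∘ suc) r c))
... | false = trans (total-map e suc (elements k (f ∘ suc)) r c) (total-elements k (f ∘ suc) (e ∘ suc) r c)

sumForms : ∀ {m n} → Circuit n m → Fin m → Fin n → ℕ
sumForms S r c = evalSUM (body S) (out S r) c

-- Cut every path where it passes from a low to a high vertex; each cut wire contributes the rectangle formed by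
-- the linear form below it and the path counts to the outputs above it.
module Crossing {m n : ℕ} (low : (Fin n → ℕ) → Bool)
  (low-unit : ∀ v → low (λ j → if does (v Fin.≟ j) then 1 else 0) ≡ true) where

  -- In the sweep from the newest gate downwards, `w v r` counts the paths from a high vertex `v` to
  -- output `r` through high gates that have been removed. The weighted sum is the part of the
  -- output still to be decomposed.
  weighted : ∀ {k} → Gates n k → (Fin (k + n) → Fin m → ℕ) → Fin m → Fin n → ℕ
  weighted {k} G w r c = ∑ (k + n) (λ v → w v r * evalSUM G v c)

  -- `g` is the form of the high vertex just above a cut. All numbers being non-negative, the paths
  -- through that vertex contribute at most the whole of `V`; this is what later limits the rows of
  -- `h`.
  BelowHigh : (Fin m → Fin n → ℕ) → (Fin m → ℕ) → Set
  BelowHigh V h = ∃ λ g → low g ≡ false × (∀ r c → g c * h r ≤ V r c)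

  -- A high gate hands its weight to its high children and emits one rectangle for each low child,
  -- charged to the wire to that child. A low gate carries weight zero and is dropped. Inputs are
  -- low, so nothing is left at the end. The bound `V` is carried along only as an inequality, since
  -- the weighted sum shrinks.
  decompose : ∀ {k} (G : Gates n k) (w : Fin (k + n) → Fin m → ℕ) →
    (∀ v r → low (evalSUM G v) ≡ true → w v r ≡ 0) → ∀ V → (∀ r c → weighted G w r c ≤ V r c) →
    ∃ λ es → length es ≤ wires G × (∀ r c → weighted G w r c ≡ total es r c) ×
      All (λ { (f , h) → low f ≡ true × BelowHigh V h }) es
  decompose [] w high V w≤V = [] , z≤n ,
    (λ r c → trans (∑-cong n λ v → cong (_* evalSUM [] v c) (high v r (low-unit v))) (∑-zero n)) , []
  decompose (_▷_ {k} G ch) w high V w≤V with low (evalSUM (G ▷ ch) zero) in eq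
  ... | true =
    let drop r c = cong (λ z → z * evalSUM (G ▷ ch) zero c + weighted G (w ∘ suc) r c) (high zero r eq)
        es , short , tot , ok = decompose G (w ∘ suc) (λ v → high (suc v)) V (λ r c → ≤-trans (m≤n+m _ _) (w≤V r c))
    in es , ≤-trans short (m≤n+m _ _) , (λ r c → trans (drop r c) (tot r c)) , ok
  ... | false = 
    let es′ , short , tot , ok = decompose G w′ high′ V (λ r c → ≤-trans (≤-trans (m≤n+m _ _) (≤-reflexive (sym (split r c)))) (w≤V r c))
    in es ++ es′
     , ≤-trans (≤-reflexive (length-++ es)) (+-mono-≤ es-short short)
     , (λ r c → trans (split r c) (trans (cong (total es r c +_) (tot r c)) (sym (total-++ es es′ r c))))
     , All.++⁺ es-ok ok
    where
    cut : Fin (k + n) → Bool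
    cut u = ch u ∧ low (evalSUM G u)
    pushed : Fin (k + n) → Bool
    pushed u = ch u ∧ not (low (evalSUM G u))
    es : List (Rectangle m n)
    es = map (λ u → evalSUM G u , w zero) (elements (k + n) cut)
    es-short : length es ≤ countTrue (k + n) ch
    es-short = ≤-trans (≤-reflexive (trans (length-map _ (elements (k + n) cut)) (length-elements (k + n) cut)))
      (countTrue-mono (k + n) λ u p → ∧-left (ch u) p)
      where
      ∧-left : ∀ a {b} → a ∧ b ≡ true → a ≡ true
      ∧-left true _ = refl
    es-ok : All (λ { (f , h) → low f ≡ true × BelowHigh V h }) es
    es-ok = All.map⁺ (All.tabulate λ {u} u∈ → ∧-right (ch u) (⇐ (∈-elements (k + n) cut u) u∈) ,
      evalSUM (G ▷ ch) zero , eq , λ r c → ≤-trans (≤-reflexive (*-comm _ (w zero r))) (≤-trans (m≤m+n _ _) (w≤V r c)))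
      where
      ∧-right : ∀ a {b} → a ∧ b ≡ true → b ≡ true
      ∧-right true p = p
    w′ : Fin (k + n) → Fin m → ℕ
    w′ u r = w (suc u) r + (if pushed u then w zero r else 0)
    high′ : ∀ u r → low (evalSUM G u) ≡ true → w′ u r ≡ 0
    high′ u r p rewrite high (suc u) r p | p | Bool.∧-zeroʳ (ch u) = refl
    split : ∀ r c → weighted (G ▷ ch) w r c ≡ total es r c + weighted G w′ r c
    split r c = begin
      w₀ * ∑ (k + n) (λ u → if ch u then evalSUM G u c else 0) + ∑ (k + n) (λ u → w (suc u) r * evalSUM G u c)
        ≡⟨ cong (_+ _) (∑-*ˡ (k + n) w₀ _) ⟨
      ∑ (k + n) (λ u → w₀ * (if ch u then evalSUM G u c else 0)) + ∑ (k + n) (λ u → w (suc u) r * evalSUM G u c)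
        ≡⟨ ∑-+ (k + n) _ _ ⟨
      ∑ (k + n) (λ u → w₀ * (if ch u then evalSUM G u c else 0) + w (suc u) r * evalSUM G u c)
        ≡⟨ ∑-cong (k + n) (λ u → redistribute (ch u) (low (evalSUM G u)) (evalSUM G u c) (w (suc u) r)) ⟩
      ∑ (k + n) (λ u → (if cut u then evalSUM G u c * w₀ else 0) + w′ u r * evalSUM G u c)
        ≡⟨ ∑-+ (k + n) _ _ ⟩
      ∑ (k + n) (λ u → if cut u then evalSUM G u c * w₀ else 0) + weighted G w′ r c
        ≡⟨ cong (_+ weighted G w′ r c) (total-elements (k + n) cut (λ u → evalSUM G u , w zero) r c) ⟨
      total es r c + weighted G w′ r c ∎
      where
      open ≡-Reasoning
      w₀ = w zero r
      redistribute : ∀ a b e x → w₀ * (if a then e else 0) + x * e ≡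
        (if a ∧ b then e * w₀ else 0) + (x + (if a ∧ not b then w₀ else 0)) * e
      redistribute true  true  e x = lemma w₀ e x
        where
        lemma : ∀ w e x → w * e + x * e ≡ e * w + (x + 0) * e
        lemma = solve-∀
      redistribute true  false e x = lemma w₀ e x
        where
        lemma : ∀ w e x → w * e + x * e ≡ 0 + (x + w) * e
        lemma = solve-∀
      redistribute false b     e x = lemma w₀ e x
        where
        lemma : ∀ w e x → w * 0 + x * e ≡ 0 + (x + 0) * e
        lemma = solve-∀

  OneRow : (Fin m → ℕ) → Set
  OneRow h = ∃ λ r₀ → ∀ r → r ≢ r₀ → h r ≡ 0

  -- An output at a low vertex has no wire to cut above it; its whole form becomes a rectangle with
  -- a single row. Such rectangles account for the summand `m`.
  decomposeCircuit : (S : Circuit n m) →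
    ∃ λ es → length es ≤ m + size S × (∀ r c → sumForms S r c ≡ total es r c) ×
      All (λ { (f , h) → low f ≡ true × (OneRow h ⊎ BelowHigh (sumForms S) h) }) es
  decomposeCircuit S =
    let es′ , short , tot , ok = decompose G w high V (λ r c → ≤-trans (m≤n+m _ _) (≤-reflexive (sym (split r c))))
    in es ++ es′
     , ≤-trans (≤-reflexive (length-++ es)) (+-mono-≤ es-short short)
     , (λ r c → trans (split r c) (trans (cong (total es r c +_) (tot r c)) (sym (total-++ es es′ r c))))
     , All.++⁺ es-ok (All.map (λ (l , b) → l , inj₂ b) ok)
    where
    G = body S
    V : Fin m → Fin n → ℕ
    V = sumForms S
    lowOut : Fin m → Bool
    lowOut r = low (evalSUM G (out S r))
    δ : Fin m → Fin m → ℕ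
    δ r₀ r = 𝟙 (does (r Fin.≟ r₀))
    es : List (Rectangle m n)
    es = map (λ r → evalSUM G (out S r) , δ r) (elements m lowOut)
    es-short : length es ≤ m
    es-short = ≤-trans (≤-reflexive (trans (length-map _ (elements m lowOut)) (length-elements m lowOut)))
      (≤-trans (countTrue-mono m {g = λ _ → true} (λ _ _ → refl)) (≤-reflexive (trans (∑-const m 1) (*-identityʳ m))))
    es-ok : All (λ { (f , h) → low f ≡ true × (OneRow h ⊎ BelowHigh V h) }) es
    es-ok = All.map⁺ (All.tabulate λ {r₀} r₀∈ → ⇐ (∈-elements m lowOut r₀) r₀∈ ,
      inj₁ (r₀ , λ r r≢r₀ → cong 𝟙 (dec-false (r Fin.≟ r₀) r≢r₀)))
    w : Fin (gates S + n) → Fin m → ℕ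
    w v r = if low (evalSUM G v) then 0 else 𝟙 (does (v Fin.≟ out S r))
    high : ∀ v r → low (evalSUM G v) ≡ true → w v r ≡ 0
    high v r p rewrite p = refl
    split : ∀ r c → V r c ≡ total es r c + weighted G w r c
    split r c = sym (begin
      total es r c + weighted G w r c
        ≡⟨ cong₂ _+_ (trans (total-elements m lowOut _ r c) (∑-single m _ r off-row)) (∑-single (gates S + n) _ (out S r) off-vertex) ⟩
      (if lowOut r then V r c * δ r r else 0) + w (out S r) r * V r c
        ≡⟨ cong₂ (λ x y → (if lowOut r then V r c * x else 0) + (if lowOut r then 0 else y) * V r c)
             (cong 𝟙 (dec-true (r Fin.≟ r) refl)) (cong 𝟙 (dec-true (out S r Fin.≟ out S r) refl)) ⟩
      (if lowOut r then V r c * 1 else 0) + (if lowOut r then 0 else 1) * V r c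
        ≡⟨ either (lowOut r) ⟩
      V r c ∎)
      where
      open ≡-Reasoning
      off-row : ∀ r₀ → r₀ ≢ r → (if lowOut r₀ then V r₀ c * δ r₀ r else 0) ≡ 0
      off-row r₀ ne with lowOut r₀
      ... | true  = trans (cong (λ z → V r₀ c * 𝟙 z) (dec-false (r Fin.≟ r₀) (ne ∘ sym))) (*-zeroʳ (V r₀ c))
      ... | false = refl
      off-vertex : ∀ v → v ≢ out S r → w v r * evalSUM G v c ≡ 0
      off-vertex v ne with low (evalSUM G v)
      ... | true  = refl
      ... | false = cong (λ z → 𝟙 z * evalSUM G v c) (dec-false (v Fin.≟ out S r) ne)
      either : ∀ b → (if b then V r c * 1 else 0) + (if b then 0 else 1) * V r c ≡ V r c
      either true  = trans (+-identityʳ _) (*-identityʳ _)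
      either false = *-identityˡ _

-- Rank of the complement of the identity over GF(2)

odd : ℕ → Bool
odd zero    = false
odd (suc n) = not (odd n)

odd-+ : ∀ a b → odd (a + b) ≡ odd a xor odd b
odd-+ zero    b = refl
odd-+ (suc a) b rewrite odd-+ a b with odd a
... | true  = Bool.not-involutive (odd b)
... | false = refl

odd-*-cong : ∀ h {a b} → odd a ≡ odd b → odd (h * a) ≡ odd (h * b)
odd-*-cong zero    e = refl
odd-*-cong (suc h) {a} {b} e = trans (odd-+ a (h * a)) (trans (cong₂ _xor_ e (odd-*-cong h e)) (sym (odd-+ b (h * b))))

odd-+-cancelʳ : ∀ a b {c d} → odd (a + c) ≡ odd (b + d) → odd c ≡ odd d → odd a ≡ odd b
odd-+-cancelʳ a b {c} {d} e f rewrite odd-+ a c | odd-+ b d | f with odd a | odd b | odd d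
... | true  | true  | _     = refl
... | false | false | _     = refl
... | true  | false | true  = sym e
... | true  | false | false = e
... | false | true  | true  = sym e
... | false | true  | false = e

odd-𝟙 : ∀ b → odd (𝟙 b) ≡ b
odd-𝟙 true  = refl
odd-𝟙 false = refl

-- The complement of the identity together with the row 1 1 … 1 has full rank over GF(2). Linear algebra is avoided:
-- the parities of the forms of the rectangles, and of the sum, determine a 0/1 vector, so there are at least 2 ^ k
-- such signatures.
crown-rank : ∀ k (es : List (Rectangle k k)) → (∀ a b → total es a b ≡ (if does (a Fin.≟ b) then 0 else 1)) → k ≤ suc (length es)
crown-rank k es crown = ≮⇒≥ λ l<k → <⇒≱ (^-monoʳ-< 2 (s≤s (s≤s z≤n)) l<k)
    (Fin.injective⇒≤ {f = to (bits↔Fin (suc (length es))) ∘ signature ∘ from (bits↔Fin k)} injective)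
  where
  open Inverse
  form : (Fin k → ℕ) → Vec Bool k → ℕ
  form f x = ∑ k (λ b → f b * 𝟙 (lookup x b))
  parities : Vec Bool k → (es : List (Rectangle k k)) → Vec Bool (length es)
  parities x []             = []
  parities x ((f , h) ∷ es) = odd (form f x) ∷ parities x es
  signature : Vec Bool k → Vec Bool (suc (length es))
  signature x = odd (form (λ _ → 1) x) ∷ parities x es
  combination : List (Rectangle k k) → Vec Bool k → Fin k → ℕ
  combination []             x a = 0
  combination ((f , h) ∷ es) x a = h a * form f x + combination es x a
  combination-total : ∀ es x a → form (total es a) x ≡ combination es x a
  combination-total []             x a = ∑-zero k
  combination-total ((f , h) ∷ es) x a = begin
    ∑ k (λ b → (f b * h a + total es a b) * 𝟙 (lookup x b))
      ≡⟨ ∑-cong k (λ b → lemma (f b) (h a) (total es a b) (𝟙 (lookup x b))) ⟩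
    ∑ k (λ b → h a * (f b * 𝟙 (lookup x b)) + total es a b * 𝟙 (lookup x b))
      ≡⟨ ∑-+ k _ _ ⟩
    ∑ k (λ b → h a * (f b * 𝟙 (lookup x b))) + form (total es a) x
      ≡⟨ cong₂ _+_ (∑-*ˡ k (h a) _) (combination-total es x a) ⟩
    h a * form f x + combination es x a ∎
    where
    open ≡-Reasoning
    lemma : ∀ f h t x → (f * h + t) * x ≡ h * (f * x) + t * x
    lemma = solve-∀
  -- Row `a` of the complement of the identity adds all coordinates of `x` except the one at `a`, so
  -- that coordinate is the full sum less a combination of the forms. Modulo 2 the signature knows
  -- both.
  sum-split : ∀ x a → form (λ _ → 1) x ≡ 𝟙 (lookup x a) + combination es x a
  sum-split x a = begin
    ∑ k (λ b → 1 * 𝟙 (lookup x b))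
      ≡⟨ ∑-cong k (λ b → case-split (does (a Fin.≟ b)) (𝟙 (lookup x b))) ⟩
    ∑ k (λ b → (if does (a Fin.≟ b) then 𝟙 (lookup x b) else 0) + (if does (a Fin.≟ b) then 0 else 1) * 𝟙 (lookup x b))
      ≡⟨ ∑-+ k _ _ ⟩
    ∑ k (λ b → if does (a Fin.≟ b) then 𝟙 (lookup x b) else 0) + ∑ k (λ b → (if does (a Fin.≟ b) then 0 else 1) * 𝟙 (lookup x b))
      ≡⟨ cong₂ _+_ (∑-single k _ a (λ b b≢a → cong (if_then 𝟙 (lookup x b) else 0) (dec-false (a Fin.≟ b) (b≢a ∘ sym))))
                   (∑-cong k (λ b → cong (_* 𝟙 (lookup x b)) (sym (crown a b)))) ⟩
    (if does (a Fin.≟ a) then 𝟙 (lookup x a) else 0) + form (total es a) x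
      ≡⟨ cong₂ _+_ (cong (if_then 𝟙 (lookup x a) else 0) (dec-true (a Fin.≟ a) refl)) (combination-total es x a) ⟩
    𝟙 (lookup x a) + combination es x a ∎
    where
    open ≡-Reasoning
    case-split : ∀ e y → 1 * y ≡ (if e then y else 0) + (if e then 0 else 1) * y
    case-split true  y = refl
    case-split false y = refl
  signature-injective : ∀ x y → signature x ≡ signature y → x ≡ y
  signature-injective x y eq = Pointwise-≡⇒≡ (ext λ a → trans (sym (odd-𝟙 (lookup x a))) (trans
      (odd-+-cancelʳ (𝟙 (lookup x a)) (𝟙 (lookup y a))
        (trans (cong odd (sym (sum-split x a))) (trans (cong Vec.head eq) (cong odd (sum-split y a))))
        (combination-odd es a (cong Vec.tail eq)))
      (odd-𝟙 (lookup y a))))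
    where
    combination-odd : ∀ es a → parities x es ≡ parities y es → odd (combination es x a) ≡ odd (combination es y a)
    combination-odd []             a eq = refl
    combination-odd ((f , h) ∷ es) a eq = trans (odd-+ (h a * form f x) _) (trans
      (cong₂ _xor_ (odd-*-cong (h a) (cong Vec.head eq)) (combination-odd es a (cong Vec.tail eq)))
      (sym (odd-+ (h a * form f y) _)))
  injective : ∀ {i j} → to (bits↔Fin (suc (length es))) (signature (from (bits↔Fin k) i)) ≡
    to (bits↔Fin (suc (length es))) (signature (from (bits↔Fin k) j)) → i ≡ j
  injective eq = Injection.injective (Inverse⇒Injection (↔-sym (bits↔Fin k)))
    (signature-injective _ _ (Injection.injective (Inverse⇒Injection (bits↔Fin (suc (length es)))) eq))

-- Counting rectangles over the ones of `A`

Free : ∀ {N M} → ℕ → (Fin N → Fin M → Bool) → Set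
Free {N} {M} t A = ∀ I J → t ≤ countTrue N I → t ≤ countTrue M J →
  ¬ (∀ i j → I i ≡ true → J j ≡ true → A i j ≡ true)

does-true : ∀ {P : Set} (P? : Dec P) → does P? ≡ true → P
does-true (yes p) _ = p

-- `row` and `col` place `Ī ⊗ A` inside a matrix that may carry padding. A row of the large matrix
-- lies over at most one row of `A`, and similarly for columns, so one-row rectangles and the forms
-- of inputs touch at most one.
module LowerBound {N M k m n t : ℕ} (1<t : 1 < t) (A : Fin N → Fin M → Bool) (free : Free t A)
  (row : Fin k → Fin N → Fin m) (row-injective : ∀ {a i a′ i′} → row a i ≡ row a′ i′ → i ≡ i′)
  (col : Fin k → Fin M → Fin n) (col-injective : ∀ {b j b′ j′} → col b j ≡ col b′ j′ → j ≡ j′)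
  (S : Circuit n m)
  (crown : ∀ a b i j → A i j ≡ true → sumForms S (row a i) (col b j) ≡ (if does (a Fin.≟ b) then 0 else 1))
  (inside : ∀ a b i j → 0 < sumForms S (row a i) (col b j) → A i j ≡ true)
  where

  V : Fin m → Fin n → ℕ
  V = sumForms S

  touches? : ∀ {n L} (col : Fin k → Fin L → Fin n) (f : Fin n → ℕ) j → Dec (∃ λ b → 0 < f (col b j))
  touches? col f j = Fin.any? λ b → 0 <? f (col b j)

  columns : (Fin n → ℕ) → Fin M → Bool
  columns f j = does (touches? col f j)

  rows : (Fin m → ℕ) → Fin N → Bool
  rows h i = does (touches? row h i)

  low : (Fin n → ℕ) → Bool
  low f = does (countTrue M (columns f) <? t)

  low-unit : ∀ v → low (λ j → if does (v Fin.≟ j) then 1 else 0) ≡ true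
  low-unit v = dec-true (_ <? t) (≤-<-trans (countTrue-unique M (columns unit) unique) 1<t)
    where
    unit : Fin n → ℕ
    unit j = if does (v Fin.≟ j) then 1 else 0
    at : ∀ c → 0 < unit c → v ≡ c
    at c p with v Fin.≟ c
    ... | yes v≡c = v≡c
    unique : ∀ i j → columns unit i ≡ true → columns unit j ≡ true → i ≡ j
    unique i j p q with b , p′ ← does-true (touches? col unit i) p | b′ , q′ ← does-true (touches? col unit j) q =
      col-injective (trans (sym (at _ p′)) (at _ q′))

  open Crossing {m} {n} low low-unit

  Small : Rectangle m n → Set
  Small (f , h) = countTrue M (columns f) ≤ t × countTrue N (rows h) ≤ t

  oneRow-small : ∀ h → OneRow h → countTrue N (rows h) ≤ t
  oneRow-small h (r₀ , off) = ≤-trans (countTrue-unique N (rows h) unique) (<⇒≤ 1<t)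
    where
    at : ∀ r → 0 < h r → r ≡ r₀
    at r p with r Fin.≟ r₀
    ... | yes r≡r₀ = r≡r₀
    ... | no  r≢r₀ = ⊥-elim (<⇒≢ p (sym (off r r≢r₀)))
    unique : ∀ i j → rows h i ≡ true → rows h j ≡ true → i ≡ j
    unique i j p q with a , p′ ← does-true (touches? row h i) p | a′ , q′ ← does-true (touches? row h j) q =
      row-injective (trans (at _ p′) (sym (at _ q′)))

  -- Wherever `g` and `h` are both positive, so is `V`. Hence the rows of `h` and the columns of `g`
  -- span an all-ones submatrix of `A`; as `g` is high it has at least `t` columns, and freeness
  -- limits the rows.
  belowHigh-small : ∀ h → BelowHigh V h → countTrue N (rows h) ≤ t
  belowHigh-small h (g , high , g*h≤V) = ≮⇒≥ λ t<rows → free (rows h) (columns g) (<⇒≤ t<rows) t≤cols λ i j p q →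
    let a , h>0 = does-true (touches? row h i) p
        b , g>0 = does-true (touches? col g j) q
    in inside a b i j (≤-trans (*-mono-≤ g>0 h>0) (g*h≤V (row a i) (col b j)))
    where
    t≤cols : t ≤ countTrue M (columns g)
    t≤cols = ≮⇒≥ λ lt → case trans (sym high) (dec-true (_ <? t) lt) of λ ()

  small : ∀ e → low (proj₁ e) ≡ true × (OneRow (proj₂ e) ⊎ BelowHigh V (proj₂ e)) → Small e
  small (f , h) (l , r) = <⇒≤ (does-true (_ <? t) l) , [ oneRow-small h , belowHigh-small h ]′ r

  meets : Rectangle m n → Fin N → Fin M → Bool
  meets (f , h) i j = rows h i ∧ columns f j

  meeting : List (Rectangle m n) → Fin N → Fin M → ℕ
  meeting []       i j = 0
  meeting (e ∷ es) i j = 𝟙 (meets e i j) + meeting es i j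

  -- Restricted to the copy of `Ī` over `(i , j)`, every rectangle that does not meet this pair
  -- vanishes and can be discarded.
  block : ∀ es i j → ∃ λ (es′ : List (Rectangle k k)) → length es′ ≡ meeting es i j ×
    (∀ a b → total es′ a b ≡ total es (row a i) (col b j))
  block [] i j = [] , refl , λ _ _ → refl
  block ((f , h) ∷ es) i j with es′ , len , tot ← block es i j | touches? row h i | touches? col f j
  ... | yes _ | yes _ = ((λ b → f (col b j)) , (λ a → h (row a i))) ∷ es′ , cong suc len , λ a b → cong (_ +_) (tot a b)
  ... | yes _ | no ¬p = es′ , len , λ a b → trans (tot a b)
    (cong (λ z → z * h (row a i) + total es (row a i) (col b j)) (sym (n≤0⇒n≡0 (≮⇒≥ λ lt → ¬p (b , lt)))))
  ... | no ¬p | _     = es′ , len , λ a b → trans (tot a b) (cong (_+ total es (row a i) (col b j))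
    (sym (trans (cong (f (col b j) *_) (n≤0⇒n≡0 (≮⇒≥ λ lt → ¬p (a , lt)))) (*-zeroʳ (f (col b j))))))

  -- Double counting: a small rectangle meets at most `t * t` pairs `(i , j)`.
  meeting-sum : ∀ es → All Small es → ∑ N (λ i → ∑ M (meeting es i)) ≤ length es * (t * t)
  meeting-sum [] [] = ≤-reflexive (trans (∑-cong N (λ i → ∑-zero M)) (∑-zero N))
  meeting-sum ((f , h) ∷ es) ((f-small , h-small) ∷ small) = begin
    ∑ N (λ i → ∑ M (λ j → 𝟙 (meets (f , h) i j) + meeting es i j))
      ≡⟨ ∑-cong N (λ i → ∑-+ M _ _) ⟩
    ∑ N (λ i → countTrue M (meets (f , h) i) + ∑ M (meeting es i))
      ≡⟨ ∑-+ N _ _ ⟩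
    ∑ N (λ i → countTrue M (meets (f , h) i)) + ∑ N (λ i → ∑ M (meeting es i))
      ≤⟨ +-mono-≤ (≤-reflexive rectangle) (meeting-sum es small) ⟩
    countTrue M (columns f) * countTrue N (rows h) + length es * (t * t)
      ≤⟨ +-monoˡ-≤ _ (*-mono-≤ f-small h-small) ⟩
    t * t + length es * (t * t) ∎
    where
    open ≤-Reasoning
    one-row : ∀ b → countTrue M (λ j → b ∧ columns f j) ≡ countTrue M (columns f) * 𝟙 b
    one-row true  = sym (*-identityʳ _)
    one-row false = trans (∑-zero M) (sym (*-zeroʳ (countTrue M (columns f))))
    rectangle : ∑ N (λ i → countTrue M (meets (f , h) i)) ≡ countTrue M (columns f) * countTrue N (rows h)
    rectangle = trans (∑-cong N λ i → one-row (rows h i)) (∑-*ˡ N (countTrue M (columns f)) _)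

  lowerBound : pred k * ∑ N (λ i → countTrue M (A i)) ≤ (m + size S) * (t * t)
  lowerBound with es , short , tot , ok ← decomposeCircuit S = begin
    pred k * ∑ N (λ i → countTrue M (A i))                 ≡⟨ ∑-*ˡ N (pred k) _ ⟨
    ∑ N (λ i → pred k * countTrue M (A i))                 ≡⟨ ∑-cong N (λ i → ∑-*ˡ M (pred k) _) ⟨
    ∑ N (λ i → ∑ M (λ j → pred k * 𝟙 (A i j)))             ≤⟨ ∑-mono N (λ i → ∑-mono M (entry es tot i)) ⟩
    ∑ N (λ i → ∑ M (meeting es i))                         ≤⟨ meeting-sum es (All.map (λ {e} → small e) ok) ⟩
    length es * (t * t)                                    ≤⟨ *-monoˡ-≤ (t * t) short ⟩
    (m + size S) * (t * t)                                 ∎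
    where
    open ≤-Reasoning
    entry : ∀ es → (∀ r c → V r c ≡ total es r c) → ∀ i j → pred k * 𝟙 (A i j) ≤ meeting es i j
    entry es tot i j with A i j in eq
    ... | false = ≤-trans (≤-reflexive (*-zeroʳ (pred k))) z≤n
    -- The rectangles meeting a one of `A` decompose `Ī` exactly. The rank bound loses 1 to the
    -- added row of ones, hence `pred k`.
    ... | true with es′ , len , tot′ ← block es i j = ≤-trans (≤-reflexive (*-identityʳ (pred k)))
      (≤-trans (pred-mono-≤ (crown-rank k es′ λ a b → trans (tot′ a b) (trans (sym (tot _ _)) (crown a b i j eq)))) (≤-reflexive len))

-- Dense matrices without large all-ones submatrices

-- Summation over a finite type with mass elements; the pigeonhole field makes the probabilistic method constructive.
record Summation (B : Set) : Set₁ where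
  field
    Σ[_]       : (B → ℕ) → ℕ
    mass       : ℕ
    cong-Σ     : ∀ {f g} → (∀ b → f b ≡ g b) → Σ[ f ] ≡ Σ[ g ]
    +-Σ        : ∀ f g → Σ[ (λ b → f b + g b) ] ≡ Σ[ f ] + Σ[ g ]
    *-Σ        : ∀ a f → Σ[ (λ b → a * f b) ] ≡ a * Σ[ f ]
    pigeonhole : ∀ K f → Σ[ f ] < mass * K → ∃ λ b → f b < K

open Summation

bool : Summation Bool
bool = record
  { Σ[_] = λ f → f true + f false ; mass = 2
  ; cong-Σ = λ e → cong₂ _+_ (e true) (e false)
  ; +-Σ = λ f g → interchange +-commutativeSemigroup (f true) (g true) (f false) (g false)
  ; *-Σ = λ a f → sym (*-distribˡ-+ a (f true) (f false))
  ; pigeonhole = pigeon }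
  where
  pigeon : ∀ K (f : Bool → ℕ) → f true + f false < 2 * K → ∃ λ b → f b < K
  pigeon K f lt with f true <? K | f false <? K
  ... | yes p | _     = true , p
  ... | no _  | yes p = false , p
  ... | no p  | no q  = ⊥-elim (<⇒≱ lt (≤-trans (≤-reflexive (cong (K +_) (+-identityʳ K))) (+-mono-≤ (≮⇒≥ p) (≮⇒≥ q))))

extend : ∀ {B : Set} {m} → B → (Fin m → B) → Fin (suc m) → B
extend b f zero    = b
extend b f (suc i) = f i

-- Coordinates are summed one after another, and `pigeonhole` fixes them in the same order: this is
-- the method of conditional expectations.
functions : ∀ {B} → Summation B → ∀ m → Summation (Fin m → B)
functions s zero = record
  { Σ[_] = λ F → F λ () ; mass = 1 ; cong-Σ = λ e → e _ ; +-Σ = λ _ _ → refl ; *-Σ = λ _ _ → refl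
  ; pigeonhole = λ K F lt → (λ ()) , ≤-trans lt (≤-reflexive (*-identityˡ K)) }
functions s (suc m) = record
  { Σ[_] = λ F → Σ[_] s λ b → Σ[_] S λ f → F (extend b f)
  ; mass = mass s * mass S
  ; cong-Σ = λ e → cong-Σ s λ b → cong-Σ S λ f → e _
  ; +-Σ = λ F G → trans (cong-Σ s λ b → +-Σ S _ _) (+-Σ s _ _)
  ; *-Σ = λ a F → trans (cong-Σ s λ b → *-Σ S a _) (*-Σ s a _)
  ; pigeonhole = λ K F lt →
      let b , lt′ = pigeonhole s (mass S * K) _ (≤-trans lt (≤-reflexive (*-assoc (mass s) _ K)))
          f , lt″ = pigeonhole S K _ lt′
      in extend b f , lt″ }
  where S = functions s m

∏ : (m : ℕ) → (Fin m → ℕ) → ℕ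
∏ = foldFin _*_ 1

∏-cong : ∀ m {f g : Fin m → ℕ} → (∀ i → f i ≡ g i) → ∏ m f ≡ ∏ m g
∏-cong zero    e = refl
∏-cong (suc m) e = cong₂ _*_ (e zero) (∏-cong m (e ∘ suc))

∏-zero : ∀ m (f : Fin m → ℕ) → ∏ m f ≡ 0 → ∃ λ i → f i ≡ 0
∏-zero (suc m) f e with m*n≡0⇒m≡0∨n≡0 (f zero) e
... | inj₁ p = zero , p
... | inj₂ p = let i , q = ∏-zero m (f ∘ suc) p in suc i , q

-- Distributivity in the role of independence of the coordinates.
sum-∏ : ∀ {B} (s : Summation B) m (g : Fin m → B → ℕ) →
  Σ[_] (functions s m) (λ f → ∏ m λ i → g i (f i)) ≡ ∏ m (λ i → Σ[_] s (g i))
sum-∏ s zero    g = refl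
sum-∏ s (suc m) g = begin
  Σ[_] s (λ b → Σ[_] S (λ f → g zero b * ∏ m (λ i → g (suc i) (f i)))) ≡⟨ cong-Σ s (λ b → *-Σ S (g zero b) _) ⟩
  Σ[_] s (λ b → g zero b * R)      ≡⟨ cong-Σ s (λ b → *-comm (g zero b) R) ⟩
  Σ[_] s (λ b → R * g zero b)      ≡⟨ *-Σ s R _ ⟩
  R * Σ[_] s (g zero)              ≡⟨ *-comm R _ ⟩
  Σ[_] s (g zero) * R              ≡⟨ cong (Σ[_] s (g zero) *_) (sum-∏ s m (g ∘ suc)) ⟩
  ∏ (suc m) (λ i → Σ[_] s (g i))   ∎
  where
  open ≡-Reasoning
  S = functions s m
  R = Σ[_] S (λ f → ∏ m (λ i → g (suc i) (f i)))

-- `K` is the reciprocal of a common bound on the probabilities. The expected number of events is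
-- below 1, so some `b` has count less than 1, that is 0.
unionBound : ∀ {B} (s : Summation B) {E : Set} (ev : E → B → ℕ) (es : List E) K → 0 < mass s →
  (∀ e → Σ[_] s (ev e) * K ≤ mass s) → length es < K → ∃ λ b → ∀ {e} → e ∈ es → ev e b ≡ 0
unionBound {B} s {E} ev es K mass>0 bound few =
  let b , lt = pigeonhole s 1 (count es)
        (<-≤-trans (*-cancelʳ-< K (Σ[_] s (count es)) (mass s) small) (≤-reflexive (sym (*-identityʳ (mass s)))))
  in b , none es b (n<1⇒n≡0 lt)
  where
  count : List E → B → ℕ
  count []       b = 0
  count (e ∷ es) b = ev e b + count es b
  sum-count : ∀ es → Σ[_] s (count es) * K ≤ length es * mass s
  sum-count []       = ≤-reflexive (cong (_* K) (*-Σ s 0 (λ _ → 0)))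
  sum-count (e ∷ es) = ≤-trans (≤-reflexive (trans (cong (_* K) (+-Σ s (ev e) _)) (*-distribʳ-+ K (Σ[_] s (ev e)) _)))
    (+-mono-≤ (bound e) (sum-count es))
  small : Σ[_] s (count es) * K < mass s * K
  small = ≤-<-trans (sum-count es) (<-≤-trans (*-monoˡ-< (mass s) {{>-nonZero mass>0}} few) (≤-reflexive (*-comm K (mass s))))
  none : ∀ es b → count es b ≡ 0 → ∀ {e} → e ∈ es → ev e b ≡ 0
  none (e ∷ es) b z (here refl) = m+n≡0⇒m≡0 (ev e b) z
  none (e ∷ es) b z (there p)   = none es b (m+n≡0⇒n≡0 (ev e b) z) p

Subset : ℕ → ℕ → Set
Subset m t = ∃ λ (s : Fin m → Bool) → countTrue m s ≡ t

include : ∀ {m t} → Subset m t → Subset (suc m) (suc t)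
include (s , p) = extend true s , cong suc p

exclude : ∀ {m t} → Subset m t → Subset (suc m) t
exclude (s , p) = extend false s , p

subsets : (m t : ℕ) → List (Subset m t)
subsets m       zero    = ((λ _ → false) , ∑-zero m) ∷ []
subsets zero    (suc t) = []
subsets (suc m) (suc t) = map include (subsets m t) ++ map exclude (subsets m (suc t))

-- Pascal's rule, with the crude estimate `m ^ t` for the binomial coefficient.
length-subsets : ∀ m t → length (subsets m t) ≤ m ^ t
length-subsets m       zero    = ≤-refl
length-subsets zero    (suc t) = z≤n
length-subsets (suc m) (suc t) = begin
  length (map include (subsets m t) ++ map exclude (subsets m (suc t)))
    ≡⟨ length-++ (map include (subsets m t)) ⟩
  length (map include (subsets m t)) + length (map exclude (subsets m (suc t)))
    ≡⟨ cong₂ _+_ (length-map include (subsets m t)) (length-map exclude (subsets m (suc t))) ⟩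
  length (subsets m t) + length (subsets m (suc t))
    ≤⟨ +-mono-≤ (length-subsets m t) (length-subsets m (suc t)) ⟩
  suc m * m ^ t
    ≤⟨ *-monoʳ-≤ (suc m) (^-monoˡ-≤ t (n≤1+n m)) ⟩
  suc m * suc m ^ t ∎
  where open ≤-Reasoning

subset-of : ∀ m t (f : Fin m → Bool) → t ≤ countTrue m f →
  ∃ λ s → s ∈ subsets m t × (∀ i → proj₁ s i ≡ true → f i ≡ true)
subset-of m       zero    f le = _ , here refl , λ i ()
subset-of (suc m) (suc t) f le with f zero in eq
... | true  = let s , s∈ , sub = subset-of m t (f ∘ suc) (s≤s⁻¹ le) in
  include s , ∈-++⁺ˡ (∈-map⁺ include s∈) , λ { zero _ → eq ; (suc i) p → sub i p }
... | false = let s , s∈ , sub = subset-of m (suc t) (f ∘ suc) le in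
  exclude s , ∈-++⁺ʳ (map include (subsets m t)) (∈-map⁺ exclude s∈) , λ { zero () ; (suc i) p → sub i p }

mass-bits : ∀ M → mass (functions bool M) ≡ 2 ^ M
mass-bits zero    = refl
mass-bits (suc M) = cong (2 *_) (mass-bits M)

matrices : ∀ N M → Summation (Fin N → Fin M → Bool)
matrices N M = functions (functions bool M) N

mass-matrices : ∀ N M → mass (matrices N M) ≡ (2 ^ M) ^ N
mass-matrices zero    M = refl
mass-matrices (suc N) M = cong₂ _*_ (mass-bits M) (mass-matrices N M)

module _ {N M : ℕ} where

  agrees : Bool → Bool → ℕ
  agrees b c = 𝟙 (not (b xor c))

  -- The indicator of the event that `A` has colour `c` on all of `I × J`, written as a product over
  -- cells so that `sum-∏` evaluates its sum.
  monochromatic : (Fin N → Bool) × (Fin M → Bool) × Bool → (Fin N → Fin M → Bool) → ℕ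
  monochromatic (I , J , c) A = ∏ N λ i → ∏ M λ j → if I i ∧ J j then agrees (A i j) c else 1

  -- Each cell of `I × J` admits one value out of two, and every other cell is unconstrained.
  mono-sum : ∀ I J c → Σ[_] (matrices N M) (monochromatic (I , J , c)) * 2 ^ (countTrue N I * countTrue M J) ≡ mass (matrices N M)
  mono-sum I J c = trans (cong (_* 2 ^ (countTrue N I * countTrue M J)) (trans (sum-∏ (functions bool M) N rowEvent)
      (∏-cong N λ i → trans (sum-∏ bool M (cellEvent i)) (∏-cong M λ j → cell (I i ∧ J j) c))))
    (trans (grid N I) (sym (mass-matrices N M)))
    where
    cellEvent : Fin N → Fin M → Bool → ℕ
    cellEvent i j a = if I i ∧ J j then agrees a c else 1
    rowEvent : Fin N → (Fin M → Bool) → ℕ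
    rowEvent i f = ∏ M λ j → cellEvent i j (f j)
    cell : ∀ b c → Σ[_] bool (λ a → if b then agrees a c else 1) ≡ (if b then 1 else 2)
    cell false c     = refl
    cell true  true  = refl
    cell true  false = refl
    line : ∀ b M (J : Fin M → Bool) → ∏ M (λ j → if b ∧ J j then 1 else 2) * 2 ^ (𝟙 b * countTrue M J) ≡ 2 ^ M
    line false zero    J = refl
    line true  zero    J = refl
    line false (suc M) J = trans (*-assoc 2 (∏ M (λ _ → 2)) 1) (cong (2 *_) (line false M (J ∘ suc)))
    line true  (suc M) J with J zero
    ... | true  = trans (lemma (∏ M (λ j → if J (suc j) then 1 else 2)) (2 ^ (countTrue M (J ∘ suc) + 0)))
      (cong (2 *_) (line true M (J ∘ suc)))
      where
      lemma : ∀ x y → 1 * x * (2 * y) ≡ 2 * (x * y)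
      lemma = solve-∀
    ... | false = trans (*-assoc 2 (∏ M (λ j → if J (suc j) then 1 else 2)) (2 ^ (countTrue M (J ∘ suc) + 0)))
      (cong (2 *_) (line true M (J ∘ suc)))
    grid : ∀ N (I : Fin N → Bool) → ∏ N (λ i → ∏ M (λ j → if I i ∧ J j then 1 else 2)) * 2 ^ (countTrue N I * countTrue M J) ≡ (2 ^ M) ^ N
    grid zero    I = refl
    grid (suc N) I = begin
      x * y * 2 ^ ((𝟙 (I zero) + countTrue N (I ∘ suc)) * countTrue M J)
        ≡⟨ cong (λ e → x * y * 2 ^ e) (*-distribʳ-+ (countTrue M J) (𝟙 (I zero)) _) ⟩
      x * y * 2 ^ (𝟙 (I zero) * countTrue M J + countTrue N (I ∘ suc) * countTrue M J)
        ≡⟨ cong (x * y *_) (^-distribˡ-+-* 2 (𝟙 (I zero) * countTrue M J) _) ⟩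
      x * y * (2 ^ (𝟙 (I zero) * countTrue M J) * 2 ^ (countTrue N (I ∘ suc) * countTrue M J))
        ≡⟨ [m*n]*[o*p]≡[m*o]*[n*p] x y _ _ ⟩
      (x * 2 ^ (𝟙 (I zero) * countTrue M J)) * (y * 2 ^ (countTrue N (I ∘ suc) * countTrue M J))
        ≡⟨ cong₂ _*_ (line (I zero) M J) (grid N (I ∘ suc)) ⟩
      2 ^ M * (2 ^ M) ^ N ∎
      where
      open ≡-Reasoning
      x = ∏ M (λ j → if I zero ∧ J j then 1 else 2)
      y = ∏ N (λ i → ∏ M (λ j → if I (suc i) ∧ J j then 1 else 2))

  complement : (Fin N → Fin M → Bool) → Fin N → Fin M → Bool
  complement A i j = not (A i j)

  -- Excluding both colours makes the complement free as well. The denser of the two matrices then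
  -- has density at least 1/2, and no concentration estimate for the number of ones is required.
  noMonochromatic : ∀ t → 2 * (N ^ t * M ^ t) < 2 ^ (t * t) → ∃ λ A → Free t A × Free t (complement A)
  noMonochromatic t few =
    let A , none = unionBound (matrices N M) event events (2 ^ (t * t)) mass>0 bound (≤-<-trans length-events few)
    in A , (λ I J → free A none true I J) , λ I J l l′ mono → free A none false I J l l′ λ i j p q →
         trans (sym (Bool.not-involutive (A i j))) (cong not (mono i j p q))
    where
    Event : Set
    Event = (Subset N t × Subset M t) × Bool
    event : Event → (Fin N → Fin M → Bool) → ℕ
    event (((I , _) , (J , _)) , c) = monochromatic (I , J , c)
    colours : List Bool
    colours = true ∷ false ∷ []
    events : List Event
    events = cartesianProduct (cartesianProduct (subsets N t) (subsets M t)) colours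
    length-events : length events ≤ 2 * (N ^ t * M ^ t)
    length-events = begin
      length events
        ≡⟨ length-cartesianProductWith _,_ (cartesianProduct (subsets N t) (subsets M t)) colours ⟩
      length (cartesianProduct (subsets N t) (subsets M t)) * 2
        ≡⟨ cong (_* 2) (length-cartesianProductWith _,_ (subsets N t) (subsets M t)) ⟩
      length (subsets N t) * length (subsets M t) * 2
        ≤⟨ *-monoˡ-≤ 2 (*-mono-≤ (length-subsets N t) (length-subsets M t)) ⟩
      N ^ t * M ^ t * 2
        ≡⟨ *-comm (N ^ t * M ^ t) 2 ⟩
      2 * (N ^ t * M ^ t) ∎
      where open ≤-Reasoning
    mass>0 : 0 < mass (matrices N M)
    mass>0 = ≤-trans (m^n>0 (2 ^ M) {{m^n≢0 2 M}} N) (≤-reflexive (sym (mass-matrices N M)))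
    bound : ∀ e → Σ[_] (matrices N M) (event e) * 2 ^ (t * t) ≤ mass (matrices N M)
    bound (((I , refl) , (J , J-size)) , c) = ≤-reflexive (trans
      (cong (λ u → Σ[_] (matrices N M) (monochromatic (I , J , c)) * 2 ^ (countTrue N I * u)) (sym J-size))
      (mono-sum I J c))
    module _ (A : Fin N → Fin M → Bool) (none : ∀ {e} → e ∈ events → event e A ≡ 0) where
      cell : Subset N t → Subset M t → Bool → Fin N → Fin M → ℕ
      cell I J c i j = if proj₁ I i ∧ proj₁ J j then agrees (A i j) c else 1
      disagree : ∀ b a c → (if b then agrees a c else 1) ≡ 0 → b ≡ true × a ≢ c
      disagree true true  false _ = refl , λ ()
      disagree true false true  _ = refl , λ ()
      ∧-true : ∀ a {b} → a ∧ b ≡ true → a ≡ true × b ≡ true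
      ∧-true true p = refl , p
      ∈-colours : ∀ c → c ∈ colours
      ∈-colours true  = here refl
      ∈-colours false = there (here refl)
      free : ∀ c I J → t ≤ countTrue N I → t ≤ countTrue M J → ¬ (∀ i j → I i ≡ true → J j ≡ true → A i j ≡ c)
      free c I J tI tJ mono =
        let I′ , I∈ , I⊆ = subset-of N t I tI
            J′ , J∈ , J⊆ = subset-of M t J tJ
            i , row-zero = ∏-zero N (λ i → ∏ M (λ j → cell I′ J′ c i j))
              (none {(I′ , J′) , c} (∈-cartesianProduct⁺ (∈-cartesianProduct⁺ I∈ J∈) (∈-colours c)))
            j , cell-zero = ∏-zero M (cell I′ J′ c i) row-zero
            both , differ = disagree (proj₁ I′ i ∧ proj₁ J′ j) (A i j) c cell-zero
            p , q = ∧-true (proj₁ I′ i) both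
        in differ (mono i j (I⊆ i p) (J⊆ j q))

  countTrue-complement : ∀ A → ∑ N (λ i → countTrue M (A i)) + ∑ N (λ i → countTrue M (complement A i)) ≡ N * M
  countTrue-complement A = begin
    ∑ N (λ i → countTrue M (A i)) + ∑ N (λ i → countTrue M (complement A i)) ≡⟨ ∑-+ N _ _ ⟨
    ∑ N (λ i → countTrue M (A i) + countTrue M (complement A i))             ≡⟨ ∑-cong N (λ i → ∑-+ M _ _) ⟨
    ∑ N (λ i → ∑ M (λ j → 𝟙 (A i j) + 𝟙 (not (A i j))))  ≡⟨ ∑-cong N (λ i → ∑-cong M (λ j → one (A i j))) ⟩
    ∑ N (λ i → ∑ M (λ j → 1))                            ≡⟨ ∑-cong N (λ i → trans (∑-const M 1) (*-identityʳ M)) ⟩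
    ∑ N (λ i → M)                                        ≡⟨ ∑-const N M ⟩
    N * M ∎
    where
    open ≡-Reasoning
    one : ∀ b → 𝟙 b + 𝟙 (not b) ≡ 1
    one true  = refl
    one false = refl

  denseFree : ∀ t → 2 * (N ^ t * M ^ t) < 2 ^ (t * t) → ∃ λ A → Free t A × N * M ≤ 2 * ∑ N (λ i → countTrue M (A i))
  denseFree t few = choose (noMonochromatic t few)
    where
    ones : (Fin N → Fin M → Bool) → ℕ
    ones A = ∑ N (λ i → countTrue M (A i))
    half : ∀ {x y} → x + y ≡ N * M → x ≤ y → N * M ≤ 2 * y
    half {x} {y} e x≤y = ≤-trans (≤-reflexive (sym e)) (+-mono-≤ x≤y (≤-reflexive (sym (+-identityʳ y))))
    choose : (∃ λ A → Free t A × Free t (complement A)) → ∃ λ A → Free t A × N * M ≤ 2 * ones A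
    choose (A , free , free′) = [ (λ le → complement A , free′ , half (countTrue-complement A) le)
      , (λ ge → A , free , half (trans (+-comm (ones (complement A)) _) (countTrue-complement A)) ge) ]′ (≤-total (ones A) (ones (complement A)))

-- The witness matrix

countTrue≡0 : ∀ m f → countTrue m f ≡ 0 → ∀ i → f i ≡ false
countTrue≡0 m f z i = Bool.¬-not λ p → <⇒≱ (≤-reflexive (sym (cong 𝟙 p))) (≤-trans (term≤∑ m (𝟙 ∘ f) i) (≤-reflexive z))

-- Without wires, an OR-circuit is also a SUM-circuit for its matrix. As the lower bound rules out a
-- SUM-circuit of size 0, the minimal OR-circuit must have a wire.
wireless : ∀ {n k} (G : Gates n k) → wires G ≡ 0 → ∀ v j → evalSUM G v j ≡ 𝟙 (evalOR G v j)
wireless []       z v       j = refl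
wireless (_▷_ {k} G ch) z (suc v) j = wireless G (m+n≡0⇒n≡0 (countTrue (k + _) ch) z) v j
wireless {n} (_▷_ {k} G ch) z zero j =
    trans (trans (∑-cong (k + n) λ v → cong (if_then evalSUM G v j else 0) (unused v)) (∑-zero (k + n)))
    (cong 𝟙 (sym (trans (⋁-cong (k + n) λ v → cong (if_then evalOR G v j else false) (unused v)) (⋁-false (k + n)))))
  where
  unused : ∀ v → ch v ≡ false
  unused = countTrue≡0 (k + n) ch (m+n≡0⇒m≡0 (countTrue (k + n) ch) z)

module CrownMatrix {d N P ℓ t : ℕ} (A : Fin N → Fin (P * ℓ) → Bool) (narrow : P * ℓ ≤ N) (default : Fin N) (o : ℕ) where

  n : ℕ
  n = 2 ^ d * N + o

  index : (Vec Bool d × Fin N) ↔ Fin (2 ^ d * N)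
  index = ×↔Fin (bits↔Fin d) ↔-refl

  row : Vec Bool d → Fin N → Fin n
  row a i = Inverse.to index (a , i) ↑ˡ o

  row⁻¹ : Fin n → Vec Bool d × Fin N
  -- A padding row repeats one fixed row of the product, so its output reuses an existing gate.
  row⁻¹ r = [ Inverse.from index , (λ _ → replicate d true , default) ]′ (splitAt (2 ^ d * N) r)

  row⁻¹-row : ∀ a i → row⁻¹ (row a i) ≡ (a , i)
  row⁻¹-row a i rewrite Fin.splitAt-↑ˡ (2 ^ d * N) (Inverse.to index (a , i)) o = Inverse.strictlyInverseʳ index (a , i)

  row-injective : ∀ {a i b j} → row a i ≡ row b j → (a , i) ≡ (b , j)
  row-injective {a} {i} {b} {j} e = trans (sym (row⁻¹-row a i)) (trans (cong row⁻¹ e) (row⁻¹-row b j))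

  col : Vec Bool d → Fin (P * ℓ) → Fin n
  col b j = row b (inject≤ j narrow)

  col-injective : ∀ {a i b j} → col a i ≡ col b j → (a , i) ≡ (b , j)
  col-injective e = cong₂ _,_ (cong proj₁ (row-injective e)) (Fin.inject≤-injective narrow narrow _ _ (cong proj₂ (row-injective e)))

  open FourRussians {N} {P} {ℓ} A

  inputs : Realises n (Fin n) _≡_ 0
  inputs = record { k = 0 ; G = [] ; vertex = id ; cost = z≤n
    ; correct = λ v c → mk⇔ (does-true (v Fin.≟ c)) (dec-true (v Fin.≟ c)) }

  open Realises (crown d col inputs) using (k; G; vertex; correct; cost)

  circuit : Circuit n n
  circuit = record { gates = k ; body = G ; out = vertex ∘ inj₂ ∘ row⁻¹ }

  circuit-size : size circuit ≤ crownCost d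
  circuit-size = ≤-trans cost (≤-reflexive (+-identityʳ _))

  -- Taking whatever the circuit computes makes its correctness hold by `refl`; `matrix-entry` then
  -- identifies the embedded copy of `Ī ⊗ A`.
  matrix : Matrix n n
  matrix r c = evalOR G (out circuit r) c

  matrix-entry : ∀ a i b j → (matrix (row a i) (col b j) ≡ true) ⇔ (a ≢ b × A i j ≡ true)
  matrix-entry a i b j rewrite row⁻¹-row a i = mk⇔
    (λ p → back (⇒ (correct (inj₂ (a , i)) (col b j)) p))
    (λ (a≢b , aj) → ⇐ (correct (inj₂ (a , i)) (col b j)) (b , j , a≢b , aj , refl))
    where
    back : (∃ λ b′ → ∃ λ j′ → a ≢ b′ × A i j′ ≡ true × col b′ j′ ≡ col b j) → a ≢ b × A i j ≡ true
    back (b′ , j′ , a≢b′ , aj′ , e) with refl ← col-injective e = a≢b′ , aj′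

  sum-size : 1 < t → Free t A → ∀ S → ComputesSUM matrix S →
    pred (2 ^ d) * ∑ N (λ i → countTrue (P * ℓ) (A i)) ≤ (n + size S) * (t * t)
  sum-size 1<t free S ok = LowerBound.lowerBound 1<t A free
    (row ∘ bits) (cong proj₂ ∘ row-injective) (col ∘ bits) (cong proj₂ ∘ col-injective) S crown-entry inside
    where
    bits : Fin (2 ^ d) → Vec Bool d
    bits = Inverse.from (bits↔Fin d)
    bits-injective : ∀ {a b} → bits a ≡ bits b → a ≡ b
    bits-injective {a} {b} e = trans (sym (Inverse.strictlyInverseˡ (bits↔Fin d) a))
      (trans (cong (Inverse.to (bits↔Fin d)) e) (Inverse.strictlyInverseˡ (bits↔Fin d) b))
    crown-entry : ∀ a b i j → A i j ≡ true → evalSUM (body S) (out S (row (bits a) i)) (col (bits b) j) ≡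
      (if does (a Fin.≟ b) then 0 else 1)
    crown-entry a b i j aj = trans (ok _ _) (entry (a Fin.≟ b))
      where
      entry : (a≟b : Dec (a ≡ b)) → 𝟙 (matrix (row (bits a) i) (col (bits b) j)) ≡ (if does a≟b then 0 else 1)
      entry (yes refl) = cong 𝟙 (Bool.¬-not λ p → proj₁ (⇒ (matrix-entry (bits a) i (bits b) j) p) refl)
      entry (no a≢b)   = cong 𝟙 (⇐ (matrix-entry (bits a) i (bits b) j) (a≢b ∘ bits-injective , aj))
    inside : ∀ a b i j → 0 < evalSUM (body S) (out S (row (bits a) i)) (col (bits b) j) → A i j ≡ true
    inside a b i j p = proj₂ (⇒ (matrix-entry (bits a) i (bits b) j) (positive (≤-trans p (≤-reflexive (ok _ _)))))
      where
      positive : ∀ {b} → 0 < 𝟙 b → b ≡ true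
      positive {true} _ = refl

russian-upper : ∀ ℓ P → P * ℓ ≤ 2 ^ (ℓ + ℓ) → (A : Fin (2 ^ (ℓ + ℓ)) → Fin (P * ℓ) → Bool) →
  FourRussians.crownCost {P = P} {ℓ = ℓ} A (ℓ + ℓ) ≤ 16 * (2 ^ (ℓ + ℓ) * 2 ^ (ℓ + ℓ))
russian-upper ℓ P M≤N A = begin
  crownCost (ℓ + ℓ)
    ≤⟨ crownCost-≤ (ℓ + ℓ) ⟩
  (ℓ + ℓ) * (2 * N * P + 2 * (P * 2 ^ ℓ) * ℓ) + N * (4 * N + 4 * (P * ℓ))
    ≡⟨ lemma ℓ P N (2 ^ ℓ) ⟩
  4 * N * (P * ℓ) + 4 * (P * ℓ) * (2 ^ ℓ * ℓ) + N * (4 * N + 4 * (P * ℓ))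
    ≤⟨ +-mono-≤ (+-mono-≤ (*-monoʳ-≤ (4 * N) M≤N) (*-mono-≤ (*-monoʳ-≤ 4 M≤N) 2^ℓ*ℓ≤N)) (*-monoʳ-≤ N (+-monoʳ-≤ (4 * N) (*-monoʳ-≤ 4 M≤N))) ⟩
  4 * N * N + 4 * N * N + N * (4 * N + 4 * N)
    ≡⟨ lemma′ N ⟩
  16 * (N * N) ∎
  where
  open FourRussians {P = P} {ℓ = ℓ} A
  open ≤-Reasoning
  N = 2 ^ (ℓ + ℓ)
  2^ℓ*ℓ≤N : 2 ^ ℓ * ℓ ≤ N
  2^ℓ*ℓ≤N = ≤-trans (*-monoʳ-≤ (2 ^ ℓ) (<⇒≤ (n<2^n ℓ))) (≤-reflexive (sym (^-distribˡ-+-* 2 ℓ ℓ)))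
    where
    n<2^n : ∀ n → n < 2 ^ n
    n<2^n zero    = s≤s z≤n
    n<2^n (suc n) = ≤-trans (+-mono-≤ (≤-trans (s≤s z≤n) (n<2^n n)) (n<2^n n)) (≤-reflexive (cong (2 ^ n +_) (sym (+-identityʳ _))))
  lemma : ∀ ℓ P N w → (ℓ + ℓ) * (2 * N * P + 2 * (P * w) * ℓ) + N * (4 * N + 4 * (P * ℓ)) ≡
    4 * N * (P * ℓ) + 4 * (P * ℓ) * (w * ℓ) + N * (4 * N + 4 * (P * ℓ))
  lemma = solve-∀
  lemma′ : ∀ N → 4 * N * N + 4 * N * N + N * (4 * N + 4 * N) ≡ 16 * (N * N)
  lemma′ = solve-∀

-- The outputs contribute `n * (t * t)`, which must be absorbed. Multiplied by 16 it is at most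
-- `256 * (t * t) * (N * N)`, hence at most the cube of `N`, and the left side provides two such
-- cubes.
cube-bound : ∀ N M n a s t → N ≤ 2 * M → N * M ≤ 2 * a → pred N * a ≤ (n + s) * (t * t) → 2 ≤ N →
  n ≤ 16 * (N * N) → 256 * (t * t) ≤ N → N * (N * N) ≤ 16 * (s * (t * t))
cube-bound N M n a s t N≤2M NM≤2a cut 2≤N n≤16N² t²≤N = +-cancelˡ-≤ (N * (N * N)) _ _ (begin
  N * (N * N) + N * (N * N)                          ≡⟨ double (N * (N * N)) ⟩
  2 * (N * (N * N))                                  ≤⟨ *-monoʳ-≤ 2 (*-mono-≤ (n≤2pred 2≤N) N²≤4a) ⟩
  2 * (2 * pred N * (4 * a))                         ≡⟨ l₁ (pred N) a ⟩
  16 * (pred N * a)                                  ≤⟨ *-monoʳ-≤ 16 cut ⟩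
  16 * ((n + s) * (t * t))                           ≡⟨ l₂ 16 n s (t * t) ⟩
  16 * n * (t * t) + 16 * (s * (t * t))              ≤⟨ +-monoˡ-≤ _ (*-monoˡ-≤ (t * t) (*-monoʳ-≤ 16 n≤16N²)) ⟩
  16 * (16 * (N * N)) * (t * t) + 16 * (s * (t * t)) ≡⟨ cong (_+ 16 * (s * (t * t))) (l₃ 16 (N * N) (t * t)) ⟩
  256 * (t * t) * (N * N) + 16 * (s * (t * t))       ≤⟨ +-monoˡ-≤ _ (*-monoˡ-≤ (N * N) t²≤N) ⟩
  N * (N * N) + 16 * (s * (t * t))                   ∎)
  where
  open ≤-Reasoning
  double : ∀ x → x + x ≡ 2 * x
  double = solve-∀
  l₁ : ∀ p a → 2 * (2 * p * (4 * a)) ≡ 16 * (p * a)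
  l₁ = solve-∀
  l₂ : ∀ c n s u → c * ((n + s) * u) ≡ c * n * u + c * (s * u)
  l₂ = solve-∀
  l₃ : ∀ c x u → c * (c * x) * u ≡ c * c * u * x
  l₃ = solve-∀
  l₄ : ∀ N M → N * (2 * M) ≡ 2 * (N * M)
  l₄ = solve-∀
  n≤2pred : ∀ {n} → 2 ≤ n → n ≤ 2 * pred n
  n≤2pred (s≤s (s≤s {n = m} z≤n)) = +-mono-≤ (s≤s (z≤n {m})) (≤-reflexive (sym (+-identityʳ (suc m))))
  N²≤4a : N * N ≤ 4 * a
  N²≤4a = begin
    N * N         ≤⟨ *-monoʳ-≤ N N≤2M ⟩
    N * (2 * M)   ≡⟨ l₄ N M ⟩
    2 * (N * M)   ≤⟨ *-monoʳ-≤ 2 NM≤2a ⟩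
    2 * (2 * a)   ≡⟨ *-assoc 2 2 a ⟨
    4 * a         ∎

-- The left side is at most `c ^ 3` times the squared cube of `N`; squaring the cube bound adds
-- `c ^ 2`, and `t ^ 4` yields `e ^ 4`.
ratio-bound : ∀ c e N n D s t L → n ≤ c * (N * N) → D ≤ c * (N * N) → N * (N * N) ≤ c * (s * (t * t)) → t ≤ e * L →
  n * D ^ 2 ≤ c ^ 5 * e ^ 4 * s ^ 2 * L ^ 4
ratio-bound c e N n D s t L n≤ D≤ cube t≤ = begin
  n * D ^ 2
    ≤⟨ *-mono-≤ n≤ (^-monoˡ-≤ 2 D≤) ⟩
  c * (N * N) * (c * (N * N)) ^ 2
    ≡⟨ l₁ c N ⟩
  c ^ 3 * (N * (N * N)) ^ 2
    ≤⟨ *-monoʳ-≤ (c ^ 3) (^-monoˡ-≤ 2 (≤-trans cube (*-monoʳ-≤ c (*-monoʳ-≤ s (*-mono-≤ t≤ t≤))))) ⟩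
  c ^ 3 * (c * (s * (e * L * (e * L)))) ^ 2
    ≡⟨ l₂ c e s L ⟩
  c ^ 5 * e ^ 4 * s ^ 2 * L ^ 4 ∎
  where
  open ≤-Reasoning
  l₁ : ∀ c N → c * (N * N) * ((c * (N * N)) * ((c * (N * N)) * 1)) ≡ c * (c * (c * 1)) * (N * (N * N) * (N * (N * N) * 1))
  l₁ = solve-∀
  l₂ : ∀ c e s L → c * (c * (c * 1)) * (c * (s * (e * L * (e * L))) * (c * (s * (e * L * (e * L))) * 1)) ≡
    c * (c * (c * (c * (c * 1)))) * (e * (e * (e * (e * 1)))) * (s * (s * 1)) * (L * (L * (L * (L * 1))))
  l₂ = solve-∀

bracket : ∀ {b} → 1 < b → ∀ e n → b ^ e ≤ n → ∃ λ ℓ → e ≤ ℓ × b ^ ℓ ≤ n × n < b ^ suc ℓ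
bracket {b} 1<b e zero le = ⊥-elim (<⇒≱ (m^n>0 b {{>-nonZero (<⇒≤ 1<b)}} e) le)
bracket {b} 1<b e (suc n) le with b ^ e ≤? n
... | no ¬p = e , ≤-refl , le , ≤-<-trans (≰⇒> ¬p) (^-monoʳ-< b 1<b (n<1+n e))
... | yes p with ℓ , e≤ℓ , lo , hi ← bracket 1<b e n p with suc n <? b ^ suc ℓ
...   | yes hi′ = ℓ , e≤ℓ , m≤n⇒m≤1+n lo , hi′
...   | no ¬hi  = suc ℓ , m≤n⇒m≤1+n e≤ℓ , ≮⇒≥ ¬hi , ≤-<-trans hi (^-monoʳ-< b 1<b (n<1+n (suc ℓ)))

-- This is 2 d + 1 for d = 2 ℓ = log N. The union bound asks for `2 * N ^ (2 * t) < 2 ^ (t * t)`,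
-- that is 1 + 2 d t < t², so `t` must exceed 2 log N.
threshold : ℕ → ℕ
threshold ℓ = suc ((ℓ + ℓ) + (ℓ + ℓ))

threshold-small : ∀ ℓ → 10 ≤ ℓ → 256 * (threshold ℓ * threshold ℓ) ≤ 2 ^ (ℓ + ℓ)
threshold-small ℓ 10≤ℓ with m , refl ← m≤n⇒∃[o]m+o≡n 10≤ℓ = subst Bound (+-comm m 10) (grow m)
  where
  Bound : ℕ → Set
  Bound ℓ = 256 * (threshold ℓ * threshold ℓ) ≤ 2 ^ (ℓ + ℓ)
  next : ∀ c ℓ → 1 ≤ ℓ → c * (threshold ℓ * threshold ℓ) ≤ 2 ^ (ℓ + ℓ) →
    c * (threshold (suc ℓ) * threshold (suc ℓ)) ≤ 2 ^ (suc ℓ + suc ℓ)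
  next c ℓ 1≤ℓ ih = begin
    c * (threshold (suc ℓ) * threshold (suc ℓ)) ≤⟨ *-monoʳ-≤ c (*-mono-≤ twice twice) ⟩
    c * (2 * threshold ℓ * (2 * threshold ℓ))   ≡⟨ lemma c (threshold ℓ) ⟩
    2 * (2 * (c * (threshold ℓ * threshold ℓ))) ≤⟨ *-monoʳ-≤ 2 (*-monoʳ-≤ 2 ih) ⟩
    2 * (2 * 2 ^ (ℓ + ℓ))                       ≡⟨ cong (λ e → 2 * 2 ^ e) (+-suc ℓ ℓ) ⟨
    2 ^ (suc ℓ + suc ℓ)                         ∎
    where
    open ≤-Reasoning
    lemma : ∀ c t → c * (2 * t * (2 * t)) ≡ 2 * (2 * (c * (t * t)))
    lemma = solve-∀
    unfold : ∀ ℓ → suc ((suc ℓ + suc ℓ) + (suc ℓ + suc ℓ)) ≡ 4 + suc ((ℓ + ℓ) + (ℓ + ℓ))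
    unfold = solve-∀
    twice : threshold (suc ℓ) ≤ 2 * threshold ℓ
    twice = ≤-trans (≤-reflexive (unfold ℓ)) (≤-trans (+-monoˡ-≤ (threshold ℓ) (m≤n⇒m≤1+n (+-mono-≤ (+-mono-≤ 1≤ℓ 1≤ℓ) (+-mono-≤ 1≤ℓ 1≤ℓ))))
      (≤-reflexive (cong (threshold ℓ +_) (sym (+-identityʳ _)))))
  grow : ∀ m → Bound (m + 10)
  -- Here 256 · 41² ≤ 2²⁰; for ℓ = 9 the inequality still fails. From here on the right side
  -- quadruples at each step and the left side at most quadruples.
  grow zero    = ≤ᵇ⇒≤ _ _ tt
  grow (suc m) = next 256 (m + 10) (≤-trans (s≤s z≤n) (m≤n+m 10 m)) (grow m)

few-squares : ∀ d {M} → 1 ≤ d → M ≤ 2 ^ d → let t = suc (d + d) in 2 * ((2 ^ d) ^ t * M ^ t) < 2 ^ (t * t)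
few-squares d {M} 1≤d M≤N = ≤-<-trans (*-monoʳ-≤ 2 (*-monoʳ-≤ ((2 ^ d) ^ t) (^-monoˡ-≤ t M≤N)))
  (≤-<-trans (≤-reflexive power) (^-monoʳ-< 2 (s≤s (s≤s z≤n)) exponent))
  where
  t = suc (d + d)
  power : 2 * ((2 ^ d) ^ t * (2 ^ d) ^ t) ≡ 2 ^ suc (d * t + d * t)
  power = cong (2 *_) (trans (cong₂ _*_ (^-*-assoc 2 d t) (^-*-assoc 2 d t)) (sym (^-distribˡ-+-* 2 (d * t) (d * t))))
  exponent : suc (d * t + d * t) < t * t
  exponent = <-≤-trans (+-monoˡ-< (d * t + d * t) (s≤s (≤-trans 1≤d (m≤m+n d d)))) (≤-reflexive (cong (t +_) (sym (*-distribʳ-+ t d d))))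

GapAt : ℕ → ℕ → Set
GapAt q n = Σ (Matrix n n) λ A → Σ (Circuit n n) λ D → IsMinOR A D × (0 < size D) ×
  (∀ S → ComputesSUM A S → n * (size D ^ 2) ≤ q * (size S ^ 2) * (⌈log₂ n ⌉ ^ 4))

module AtScale (ℓ o : ℕ) .{{_ : NonZero ℓ}} (10≤ℓ : 10 ≤ ℓ)
  (n≤16N² : 2 ^ (ℓ + ℓ) * 2 ^ (ℓ + ℓ) + o ≤ 16 * (2 ^ (ℓ + ℓ) * 2 ^ (ℓ + ℓ))) where

  d N P M t n L : ℕ
  d = ℓ + ℓ
  N = 2 ^ d
  P = N / ℓ
  M = P * ℓ
  t = threshold ℓ
  n = N * N + o
  L = ⌈log₂ n ⌉

  M≤N : M ≤ N
  M≤N = m/n*n≤m N ℓ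

  1≤d : 1 ≤ d
  1≤d = ≤-trans (s≤s z≤n) (≤-trans 10≤ℓ (m≤m+n ℓ ℓ))

  1<t : 1 < t
  1<t = s≤s (≤-trans 1≤d (m≤m+n d d))

  t≤N : t ≤ N
  t≤N = ≤-trans (≤-trans (m≤m*n t t) (m≤n*m (t * t) 256)) (threshold-small ℓ 10≤ℓ)

  -- Rounding `N` down to a multiple of `ℓ` loses fewer than `ℓ` columns, and `ℓ + ℓ ≤ N`.
  N≤2M : N ≤ 2 * M
  N≤2M = +-cancelˡ-≤ N N (2 * M) (begin
    N + N                                 ≡⟨ cong₂ _+_ (m≡m%n+[m/n]*n N ℓ) (m≡m%n+[m/n]*n N ℓ) ⟩
    N % ℓ + M + (N % ℓ + M)               ≤⟨ +-mono-≤ (+-monoˡ-≤ M (<⇒≤ (m%n<n N ℓ))) (+-monoˡ-≤ M (<⇒≤ (m%n<n N ℓ))) ⟩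
    ℓ + M + (ℓ + M)                       ≡⟨ lemma ℓ M ⟩
    d + 2 * M                             ≤⟨ +-monoˡ-≤ (2 * M) (≤-trans (≤-trans (m≤m+n d d) (n≤1+n _)) t≤N) ⟩
    N + 2 * M                             ∎)
    where
    open ≤-Reasoning
    lemma : ∀ ℓ M → ℓ + M + (ℓ + M) ≡ ℓ + ℓ + 2 * M
    lemma = solve-∀

  t≤2L : t ≤ 2 * L
  t≤2L = ≤-trans (+-mono-≤ 1≤d+d (≤-refl {d + d}))
    (≤-trans (≤-reflexive (cong (d + d +_) (sym (+-identityʳ (d + d))))) (*-monoʳ-≤ 2 d+d≤L))
    where
    1≤d+d : 1 ≤ d + d
    1≤d+d = ≤-trans 1≤d (m≤m+n d d)
    d+d≤L : d + d ≤ L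
    d+d≤L = ≤-trans (≤-reflexive (sym (⌈log₂2^n⌉≡n (d + d))))
      (⌈log₂⌉-mono-≤ (≤-trans (≤-reflexive (^-distribˡ-+-* 2 d d)) (m≤m+n (N * N) o)))

  gapAt : ∀ q → 16 ^ 5 * 2 ^ 4 ≤ q → GapAt q (2 ^ (ℓ + ℓ) * 2 ^ (ℓ + ℓ) + o)
  gapAt q large = let A , free , dense = denseFree {N} {M} t (few-squares d 1≤d M≤N) in conclude A free dense
    where
    conclude : ∀ A → Free t A → N * M ≤ 2 * ∑ N (λ i → countTrue M (A i)) → GapAt q n
    conclude A free dense = fromMin (minimalOR matrix circuit (λ _ _ → refl))
      where
      open CrownMatrix {d} {N} {P} {ℓ} {t} A M≤N (fromℕ< (m^n>0 2 d)) o hiding (n)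
      cube : ∀ S → ComputesSUM matrix S → N * (N * N) ≤ 16 * (size S * (t * t))
      cube S ok = cube-bound N M n (∑ N (λ i → countTrue M (A i))) (size S) t N≤2M dense (sum-size 1<t free S ok)
        (≤-trans 1<t t≤N) n≤16N² (threshold-small ℓ 10≤ℓ)
      fromMin : (∃ λ D → IsMinOR matrix D × size D ≤ size circuit) → GapAt q n
      fromMin (D , min , D≤circuit) = matrix , D , min , n≢0⇒n>0 wired , λ S ok →
        ≤-trans (ratio-bound 16 2 N n (size D) (size S) t L n≤16N²
          (≤-trans D≤circuit (≤-trans circuit-size (russian-upper ℓ P M≤N A))) (cube S ok) t≤2L)
          (*-monoˡ-≤ (L ^ 4) (*-monoˡ-≤ (size S ^ 2) large))
        where
        wired : size D ≢ 0
        wired z = <⇒≱ (*-mono-≤ N>0 (*-mono-≤ N>0 N>0))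
          (≤-trans (cube D λ r c → trans (wireless (body D) z (out D r) c) (cong 𝟙 (proj₁ min r c)))
            (≤-reflexive (cong (λ s → 16 * (s * (t * t))) z)))
          where
          N>0 : 0 < N
          N>0 = m^n>0 2 d

square : ∀ ℓ → 16 ^ ℓ ≡ 2 ^ (ℓ + ℓ) * 2 ^ (ℓ + ℓ)
square ℓ = begin
  (2 ^ 4) ^ ℓ                     ≡⟨ ^-*-assoc 2 4 ℓ ⟩
  2 ^ (4 * ℓ)                     ≡⟨ cong (2 ^_) (lemma ℓ) ⟩
  2 ^ (ℓ + ℓ + (ℓ + ℓ))           ≡⟨ ^-distribˡ-+-* 2 (ℓ + ℓ) (ℓ + ℓ) ⟩
  2 ^ (ℓ + ℓ) * 2 ^ (ℓ + ℓ)       ∎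
  where
  open ≡-Reasoning
  lemma : ∀ ℓ → 4 * ℓ ≡ ℓ + ℓ + (ℓ + ℓ)
  lemma = solve-∀

theorem1 : Σ ℕ λ q → (1 ≤ q) × Σ ℕ λ N → ∀ n → N ≤ n →
    Σ (Matrix n n) λ A → Σ (Circuit n n) λ D →
    IsMinOR A D × (0 < size D) ×
    (∀ S → ComputesSUM A S →
    n * (size D ^ 2) ≤ q * (size S ^ 2) * (⌈log₂ n ⌉ ^ 4))
theorem1 = withConstant (16 ^ 5 * 2 ^ 4) ≤-refl
  where
  -- The constant is kept a variable, since comparing types that mention the numeral would unfold it in unary.
  withConstant : ∀ q → 16 ^ 5 * 2 ^ 4 ≤ q → ∃ λ q → 1 ≤ q × ∃ λ N → ∀ n → N ≤ n → GapAt q n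
  -- From `16 ^ 10` on, the exponent found by `bracket` is at least 10, as `threshold-small`
  -- demands.
  withConstant q large = q , ≤-trans (s≤s z≤n) large , 16 ^ 10 , λ n le → gap n (bracket (s≤s (s≤s z≤n)) 10 n le)
    where
    gap : ∀ n → (∃ λ ℓ → 10 ≤ ℓ × 16 ^ ℓ ≤ n × n < 16 ^ suc ℓ) → GapAt q n
    gap n (ℓ , 10≤ℓ , lo , hi) = split (m≤n⇒∃[o]m+o≡n (≤-trans (≤-reflexive (sym (square ℓ))) lo))
      where
      split : (∃ λ o → 2 ^ (ℓ + ℓ) * 2 ^ (ℓ + ℓ) + o ≡ n) → GapAt q n
      split (o , refl) = AtScale.gapAt ℓ o {{>-nonZero (≤-trans (s≤s z≤n) 10≤ℓ)}} 10≤ℓ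
        (≤-trans (<⇒≤ hi) (≤-reflexive (cong (16 *_) (square ℓ)))) q large
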